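{- Let $r\ge 3$ be an integer. Among connected $r$-regular graphs of order $n$, the minimum path number is quadratic in the order $n$. That is, there are constants $c_r, C_r>0$, depending only on $r$, such that for every integer $n\ge r+1$ with $rn$ even, $$c_r\, n^2\le \min\{\mathrm{pn}(G) : G \text{ is a connected } r\text{ -regular graph of order } n\}\le C_r\, n^2 .$$
   Context: Graphs are finite and simple; the order of a graph is its number of vertices. For a graph $G$ of order $n$, the path number is $\mathrm{pn}(G)=\sum_{i=0}^{n-1}\mathrm{pn}_i(G)$, where $\mathrm{pn}_i(G)$ is the number of (not necessarily induced) subgraphs of $G$ isomorphic to the path $P_{i+1}$ on $i+1$ vertices (so paths are unoriented and single vertices count as paths of length $0$). Connected $r$-regular graphs of order $n$ exist exactly when $n\ge r+1$ and $rn$ is even (for $r\ge 3$). -}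

module Defs where

open import Data.Bool.Base using (true; false)
open import Data.Fin.Base using (Fin; toℕ; finToFun; funToFin)
open import Data.Fin.Properties as Fin using (any?; all?; finToFun-funToFin)
open import Data.Fin.Subset using (Subset; _∈_; ∣_∣)
open import Data.Fin.Subset.Properties using (_∈?_)
open import Data.Integer.Base using (+_)
open import Data.List.Base
  using (List; []; _∷_; [_]; length; filter; map; upTo; cartesianProductWith; cartesianProduct)
import Data.List.Membership.Propositional as List
open import Data.List.Membership.Propositional.Properties
  using (∈-cartesianProductWith⁺; ∈-cartesianProduct⁺)
open import Data.List.Relation.Unary.All as All using ()
open import Data.List.Relation.Unary.AllPairs as AllPairs using ()
open import Data.List.Relation.Unary.Any using (here; there)
open import Data.List.Relation.Unary.Unique.Propositional using (Unique)
open import Data.List.Relation.Unary.Unique.Propositional.Properties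
  using (cartesianProductWith⁺; cartesianProduct⁺)
open import Data.Nat.Base as ℕ using (ℕ; zero; suc; _≤_)
open import Data.Nat.ListAction using (sum)
import Data.Nat.Properties as ℕ
open import Data.Product.Base using (_×_; _,_; ∃; ∃-syntax)
open import Data.Rational.Base using (ℚ; _/_)
open import Data.Sum.Base using (_⊎_)
open import Data.Vec.Base using (Vec; []; _∷_; lookup)
open import Data.Vec.Properties using (∷-injective)
open import Function.Bundles using (_⇔_; mk⇔; Equivalence)
open import Function.Definitions using (Injective)
open import Level using (0ℓ)
open import Relation.Binary.Construct.Closure.ReflexiveTransitive using (Star)
open import Relation.Binary.Core using (Rel)
import Relation.Binary.Definitions as B
open import Relation.Binary.PropositionalEquality
  using (_≡_; _≢_; _≗_; refl; sym; trans; subst₂)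
open import Relation.Nullary.Decidable
  using (Dec; map′; _×-dec_; _⊎-dec_; _→-dec_)
open import Relation.Unary using (Pred; Decidable)

private
  variable
    n k : ℕ
    A : Set

-- Row u of a matrix is the neighbourhood of u.
Matrix : ℕ → Set
Matrix n = Vec (Subset n) n

Edge : Matrix n → Rel (Fin n) 0ℓ
Edge M u v = v ∈ lookup M u

edge? : (M : Matrix n) → B.Decidable (Edge M)
edge? M u v = v ∈? lookup M u

-- Finite simple graphs of order n, on the vertex set Fin n.
record Graph (n : ℕ) : Set where
  field
    matrix      : Matrix n
    symmetric   : B.Symmetric (Edge matrix)
    irreflexive : B.Irreflexive _≡_ (Edge matrix)

  Adj : Rel (Fin n) 0ℓ
  Adj = Edge matrix

  degree : Fin n → ℕ
  degree u = ∣ lookup matrix u ∣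

open Graph public

Regular : ℕ → Graph n → Set
Regular r G = ∀ u → degree G u ≡ r

Connected : Graph n → Set
Connected G = ∀ u v → Star (Adj G) u v

-- A pair (S , M) encodes the vertex set and the edge set of a prospective
-- subgraph.  Absence of loops in M follows from M being contained in G.
IsSubgraph : Graph n → Subset n × Matrix n → Set
IsSubgraph G (S , M) =
  B.Symmetric (Edge M) × (∀ u v → Edge M u v → u ∈ S × v ∈ S × Adj G u v)

-- Adjacency in the path on the vertices 0, 1, …, k - 1.
PathAdj : (k : ℕ) → Rel (Fin k) 0ℓ
PathAdj k i j = suc (toℕ i) ≡ toℕ j ⊎ suc (toℕ j) ≡ toℕ i

-- f is an isomorphism from the graph (Fin k , R) to the graph (S , M).
IsIsomorphism : Rel (Fin k) 0ℓ → Subset n × Matrix n → (Fin k → Fin n) → Set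
IsIsomorphism R (S , M) f =
  Injective _≡_ _≡_ f ×
  (∀ v → v ∈ S ⇔ (∃[ i ] f i ≡ v)) ×
  (∀ i j → R i j ⇔ Edge M (f i) (f j))

IsPathSubgraph : Graph n → ℕ → Subset n × Matrix n → Set
IsPathSubgraph G k H = IsSubgraph G H × ∃ (IsIsomorphism (PathAdj k) H)

private
  _⇔-dec_ : ∀ {P Q : Set} → Dec P → Dec Q → Dec (P ⇔ Q)
  p? ⇔-dec q? = map′ (λ (f , g) → mk⇔ f g) (λ e → Equivalence.to e , Equivalence.from e)
                     ((p? →-dec q?) ×-dec (q? →-dec p?))

  anyFunction? : {P : Pred (Fin k → Fin n) 0ℓ} →
                 (∀ {f g} → f ≗ g → P f → P g) → Decidable P → Dec (∃ P)
  anyFunction? resp P? =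
    map′ (λ (c , p) → finToFun c , p)
         (λ (f , p) → funToFin f , resp (λ i → sym (finToFun-funToFin f i)) p)
         (any? (λ c → P? (finToFun c)))

isSubgraph? : (G : Graph n) → Decidable (IsSubgraph G)
isSubgraph? G (S , M) =
  map′ (λ s {u} {v} → s u v) (λ s u v → s {u} {v})
       (all? λ u → all? λ v → edge? M u v →-dec edge? M v u)
  ×-dec
  (all? λ u → all? λ v →
     edge? M u v →-dec ((u ∈? S) ×-dec (v ∈? S) ×-dec edge? (matrix G) u v))

pathAdj? : ∀ k → B.Decidable (PathAdj k)
pathAdj? k i j = (suc (toℕ i) ℕ.≟ toℕ j) ⊎-dec (suc (toℕ j) ℕ.≟ toℕ i)

isIsomorphism? : {R : Rel (Fin k) 0ℓ} → B.Decidable R →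
                 (H : Subset n × Matrix n) → Decidable (IsIsomorphism R H)
isIsomorphism? R? (S , M) f =
  map′ (λ h {i} {j} → h i j) (λ h i j → h {i} {j})
       (all? λ i → all? λ j → (f i Fin.≟ f j) →-dec (i Fin.≟ j))
  ×-dec (all? λ v → (v ∈? S) ⇔-dec any? (λ i → f i Fin.≟ v))
  ×-dec (all? λ i → all? λ j → R? i j ⇔-dec edge? M (f i) (f j))

isIsomorphism-resp : {R : Rel (Fin k) 0ℓ} (H : Subset n × Matrix n) {f g : Fin k → Fin n} →
                     f ≗ g → IsIsomorphism R H f → IsIsomorphism R H g
isIsomorphism-resp (S , M) f≗g (inj , onto , adj) =
    (λ {i} {j} gi≡gj → inj (trans (f≗g i) (trans gi≡gj (sym (f≗g j)))))
  , (λ v → mk⇔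
      (λ v∈S → let (i , fi≡v) = Equivalence.to (onto v) v∈S in
               i , trans (sym (f≗g i)) fi≡v)
      (λ (i , gi≡v) → Equivalence.from (onto v) (i , trans (f≗g i) gi≡v)))
  , (λ i j → mk⇔
      (λ r → subst₂ (Edge M) (f≗g i) (f≗g j) (Equivalence.to (adj i j) r))
      (λ e → Equivalence.from (adj i j)
               (subst₂ (Edge M) (sym (f≗g i)) (sym (f≗g j)) e)))

isPathSubgraph? : (G : Graph n) (k : ℕ) → Decidable (IsPathSubgraph G k)
isPathSubgraph? G k H =
  isSubgraph? G H ×-dec
  anyFunction? (isIsomorphism-resp H) (isIsomorphism? (pathAdj? k) H)

vectors : List A → (n : ℕ) → List (Vec A n)
vectors xs zero    = [ [] ]
vectors xs (suc n) = cartesianProductWith _∷_ xs (vectors xs n)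

subsets : (n : ℕ) → List (Subset n)
subsets = vectors (true ∷ false ∷ [])

candidates : (n : ℕ) → List (Subset n × Matrix n)
candidates n = cartesianProduct (subsets n) (vectors (subsets n) n)

-- candidates lists every pair exactly once, so that filtering it counts.

∈-vectors : {xs : List A} → (∀ x → x List.∈ xs) → (v : Vec A n) → v List.∈ vectors xs n
∈-vectors all []      = here refl
∈-vectors all (x ∷ v) = ∈-cartesianProductWith⁺ _∷_ (all x) (∈-vectors all v)

vectors-unique : {xs : List A} → Unique xs → ∀ n → Unique (vectors xs n)
vectors-unique u zero    = All.[] AllPairs.∷ AllPairs.[]
vectors-unique u (suc n) = cartesianProductWith⁺ _∷_ ∷-injective u (vectors-unique u n)

∈-subsets : (S : Subset n) → S List.∈ subsets n
∈-subsets = ∈-vectors λ { true → here refl ; false → there (here refl) }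

subsets-unique : ∀ n → Unique (subsets n)
subsets-unique = vectors-unique
  (((λ ()) All.∷ All.[]) AllPairs.∷ (All.[] AllPairs.∷ AllPairs.[]))

∈-candidates : (H : Subset n × Matrix n) → H List.∈ candidates n
∈-candidates (S , M) = ∈-cartesianProduct⁺ (∈-subsets S) (∈-vectors ∈-subsets M)

candidates-unique : ∀ n → Unique (candidates n)
candidates-unique n =
  cartesianProduct⁺ (subsets-unique n) (vectors-unique (subsets-unique n) n)

-- The number of subgraphs of G isomorphic to the path on i + 1 vertices.
pnᵢ : Graph n → ℕ → ℕ
pnᵢ {n} G i = length (filter (isPathSubgraph? G (suc i)) (candidates n))

pn : Graph n → ℕ
pn {n} G = sum (map (pnᵢ G) (upTo n))

IsMinimum : Pred ℕ 0ℓ → ℕ → Set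
IsMinimum P m = P m × (∀ k → P k → m ≤ k)

PathNumbers : (r n : ℕ) → Pred ℕ 0ℓ
PathNumbers r n m = ∃[ G ] Connected {n} G × Regular r G × pn G ≡ m

fromℕ : ℕ → ℚ
fromℕ m = + m / 1

{-# OPTIONS --safe #-}
module Submission where

-- Lower bound: any two vertices of a connected graph are joined by a path, and a path
-- determines its ends, so n² ≤ 2 pn.
-- Upper bound: arrange about n / b beads of bounded order b in a ring, and join consecutive beads
-- by an edge between their roots.  A simple path that leaves a bead does so through its root, so
-- it is a walk inside its first bead, an arc of the ring in one of two directions, and a walk
-- inside its last bead; this leaves O(n²) choices.  A bead is a circulant graph in which the edges
-- from 0 to -1 and to h are traded for an edge between -1 and h, so that the root 0 has two free
-- ports for its neighbours on the ring.

open import Defs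
open import Data.Bool.Base using (Bool; true; false; not; if_then_else_)
import Data.Bool.Properties as Bool
open import Data.Fin.Base as Fin using (Fin; zero; suc; toℕ; fromℕ<; inject₁)
import Data.Fin.Properties as Fin
open import Data.Fin.Subset using (Subset; ∣_∣) renaming (_∈_ to _∈ₛ_)
open import Data.Fin.Subset.Properties using (⊆-antisym) renaming (_∈?_ to _∈ₛ?_)
import Data.Integer.Base as ℤ
import Data.Integer.Properties as ℤ
open import Data.List.Base as List
  using (List; []; _∷_; [_]; _++_; length; lookup; filter; map; concatMap; tabulate; allFin; upTo;
         cartesianProduct; cartesianProductWith)
open import Data.List.Membership.Propositional using (_∈_; _∉_; lose)
open import Data.List.Membership.Propositional.Properties
import Data.List.Properties as List
open import Data.List.Relation.Unary.All as All using (All; []; _∷_)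
import Data.List.Relation.Unary.All.Properties as All
open import Data.List.Relation.Unary.AllPairs using ([]; _∷_)
open import Data.List.Relation.Unary.Any as Any using (Any; here; there)
open import Data.List.Relation.Unary.Unique.Propositional using (Unique)
import Data.List.Relation.Unary.Unique.Propositional.Properties as Unique
open import Data.Nat.Base as ℕ using (ℕ; zero; suc; _+_; _*_; _≤_; _<_; z≤n; s≤s)
open import Data.Nat.DivMod
open import Data.Nat.Divisibility
  using (_∣_; m∣m*n; ∣m+n∣m⇒∣n; ∣m∣n⇒∣m+n; %-presˡ-∣)
open import Data.Nat.Induction using (<-rec)
open import Data.Nat.ListAction using (sum)
import Data.Nat.Properties as ℕ
open import Data.Nat.Solver using (module +-*-Solver)
open import Data.Product.Base using (_×_; _,_; ∃; ∃-syntax; proj₁; proj₂)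
open import Data.Rational.Base as ℚ using (ℚ; 0ℚ; 1ℚ; ½; toℚᵘ)
import Data.Rational.Properties as ℚ
open import Data.Rational.Unnormalised.Base as ℚᵘ using (mkℚᵘ; *≡*; *≤*)
import Data.Rational.Unnormalised.Properties as ℚᵘ
open import Data.Sum.Base using (_⊎_; inj₁; inj₂)
open import Data.Sum.Function.Propositional using (_⊎-↔_)
import Data.Sum.Properties as Sum
open import Data.Vec.Base as Vec using ([]; _∷_)
import Data.Vec.Properties as Vec
open import Function.Base using (_∘_; id)
open import Function.Bundles using (_⇔_; mk⇔; Equivalence; _↔_; mk↔ₛ′; Inverse)
open import Function.Definitions using (Injective)
open import Function.Properties.Inverse using (↔-refl; ↔-sym; ↔-trans)
open import Level using (0ℓ)
open import Relation.Binary.Construct.Closure.ReflexiveTransitive as Star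
  using (Star; ε; _◅_; _◅◅_)
open import Relation.Binary.Core using (Rel)
import Relation.Binary.Definitions as B
open import Relation.Binary.PropositionalEquality
  using (_≡_; _≢_; _≗_; refl; sym; trans; cong; cong₂; subst; subst₂; module ≡-Reasoning)
open import Relation.Nullary using (¬_; Dec; yes; no; does; contradiction)
open import Relation.Nullary.Decidable using (map′; _×-dec_; _→-dec_; ¬?)
open import Relation.Unary using (Pred; Decidable)

-- The count stays quadratic because a bead that is merely passed offers no choice: a walk enters it
-- at the root, the root is also the only exit, and simplicity forbids a second visit. Choices
-- inside the first and the last bead are bounded in terms of `r`; the starting bead and the number
-- of beads passed contribute a factor of order n each. Trading two edges at the root for a chord
-- keeps every degree, provided the chord is new. This is why the root's former neighbours are -1
-- and h: they differ by h + 1, just beyond the longest jump, and a bead of order at least 2h + 4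
-- admits no other jump of that size. Since r is at least 3, the root keeps a third port, which ties
-- it to the rest of its bead. An order that is not a multiple of the bead order is reached by
-- enlarging one bead by the remainder. Orders too small for three beads are bounded in terms of `r`
-- and are absorbed into the constant. The minimum has to be exhibited, so membership in
-- `PathNumbers r n` is decided by searching all adjacency matrices.

-- Counting by injections and words of bounded length

-- Pigeonhole: the partner of `x` is deleted from `ys`, and injectivity ensures that nobody else
-- needs it. A relation replaces a function because one object may have several partners, as a path
-- has two directions.
length-≤ : {A B : Set} {xs : List A} {ys : List B} (R : A → B → Set) → Unique xs →
           (∀ {x} → x ∈ xs → ∃[ y ] y ∈ ys × R x y) →
           (∀ {x x′ y} → R x y → R x′ y → x ≡ x′) → length xs ≤ length ys
length-≤ {xs = []} R _ _ _ = z≤n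
length-≤ {xs = x ∷ xs} R (x∉xs ∷ uniq) total inj with total (here refl)
... | y , y∈ys , Rxy with ∈-∃++ y∈ys
... | ys₁ , ys₂ , refl = begin
  suc (length xs)            ≤⟨ s≤s (length-≤ R uniq total′ inj) ⟩
  suc (length (ys₁ ++ ys₂))  ≡⟨ List.length-++-sucʳ ys₁ y ys₂ ⟨
  length (ys₁ ++ y ∷ ys₂)    ∎
  where
  open ℕ.≤-Reasoning
  total′ : ∀ {x′} → x′ ∈ xs → ∃[ y′ ] y′ ∈ ys₁ ++ ys₂ × R x′ y′
  total′ x′∈xs with total (there x′∈xs)
  ... | y′ , y′∈ , Rx′y′ with ∈-++⁻ ys₁ y′∈
  ... | inj₁ y′∈₁           = y′ , ∈-++⁺ˡ y′∈₁ , Rx′y′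
  ... | inj₂ (there y′∈₂)   = y′ , ∈-++⁺ʳ ys₁ y′∈₂ , Rx′y′
  ... | inj₂ (here refl)    = contradiction (inj Rxy Rx′y′) (All.lookup x∉xs x′∈xs)

length-⊆ : {A : Set} {xs ys : List A} → Unique xs → (∀ {x} → x ∈ xs → x ∈ ys) →
           length xs ≤ length ys
length-⊆ uniq xs⊆ys = length-≤ _≡_ uniq (λ x∈ → _ , xs⊆ys x∈ , refl) (λ { refl refl → refl })

length-cartesianProductWith : {A B C : Set} (f : A → B → C) (xs : List A) (ys : List B) →
  length (cartesianProductWith f xs ys) ≡ length xs * length ys
length-cartesianProductWith f []       ys = refl
length-cartesianProductWith f (x ∷ xs) ys =
  trans (List.length-++ (map (f x) ys))
        (cong₂ _+_ (List.length-map (f x) ys) (length-cartesianProductWith f xs ys))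

-- Presents the sum defining `pn` as the length of a single list, to which `length-≤` applies.
sum-length-filter : {A B : Set} {P : A → Pred B 0ℓ} (P? : ∀ a → Decidable (P a))
                    (xs : List A) (ys : List B) →
  sum (map (λ a → length (filter (P? a) ys)) xs) ≡
  length (filter (λ (a , b) → P? a b) (cartesianProduct xs ys))
sum-length-filter P? []       ys = refl
sum-length-filter P? (x ∷ xs) ys = begin
  length (filter (P? x) ys) + sum (map (λ a → length (filter (P? a) ys)) xs)
    ≡⟨ cong₂ _+_ (row ys) (sum-length-filter P? xs ys) ⟩
  length (filter Q? (map (x ,_) ys)) + length (filter Q? (cartesianProduct xs ys))
    ≡⟨ List.length-++ (filter Q? (map (x ,_) ys)) ⟨
  length (filter Q? (map (x ,_) ys) ++ filter Q? (cartesianProduct xs ys))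
    ≡⟨ cong length (List.filter-++ Q? (map (x ,_) ys) (cartesianProduct xs ys)) ⟨
  length (filter Q? (cartesianProduct (x ∷ xs) ys)) ∎
  where
  open ≡-Reasoning
  Q? = λ (a , b) → P? a b
  row : ∀ zs → length (filter (P? x) zs) ≡ length (filter Q? (map (x ,_) zs))
  row []       = refl
  row (z ∷ zs) with does (P? x z)
  ... | true  = cong suc (row zs)
  ... | false = row zs

listsUpTo : {A : Set} → List A → ℕ → List (List A)
listsUpTo xs zero    = [ [] ]
listsUpTo xs (suc k) = [] ∷ cartesianProductWith _∷_ xs (listsUpTo xs k)

∈-listsUpTo : {A : Set} {xs ws : List A} {k : ℕ} → length ws ≤ k → All (_∈ xs) ws →
               ws ∈ listsUpTo xs k
∈-listsUpTo {k = zero}  z≤n     []         = here refl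
∈-listsUpTo {k = suc k} _       []         = here refl
∈-listsUpTo {k = suc k} (s≤s l) (w∈ ∷ ws∈) =
  there (∈-cartesianProductWith⁺ _∷_ w∈ (∈-listsUpTo l ws∈))

-- The geometric sum 1 + b + ... + b^k, counting the words of length at most k over b letters.
numLists : ℕ → ℕ → ℕ
numLists b zero    = 1
numLists b (suc k) = suc (b * numLists b k)

numLists-positive : ∀ b k → 1 ≤ numLists b k
numLists-positive b zero    = s≤s z≤n
numLists-positive b (suc k) = s≤s z≤n

length-listsUpTo : {A : Set} {b : ℕ} {xs : List A} (k : ℕ) → length xs ≤ b →
                    length (listsUpTo xs k) ≤ numLists b k
length-listsUpTo zero _ = ℕ.≤-refl
length-listsUpTo {b = b} {xs} (suc k) l = s≤s (begin
  length (cartesianProductWith _∷_ xs (listsUpTo xs k)) ≡⟨ length-cartesianProductWith _∷_ xs _ ⟩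
  length xs * length (listsUpTo xs k)                   ≤⟨ ℕ.*-mono-≤ l (length-listsUpTo k l) ⟩
  b * numLists b k                                      ∎)
  where open ℕ.≤-Reasoning

-- Subsets and matrices of decidable relations

module _ {n : ℕ} where

  subset : {P : Pred (Fin n) 0ℓ} → Decidable P → Subset n
  subset P? = Vec.tabulate (does ∘ P?)

  ∈-subset⁺ : {P : Pred (Fin n) 0ℓ} (P? : Decidable P) {v : Fin n} → P v → v ∈ₛ subset P?
  ∈-subset⁺ P? {v} Pv = Vec.lookup⇒[]= v _ (trans (Vec.lookup∘tabulate (does ∘ P?) v) (eq (P? v)))
    where
    eq : ∀ d → does d ≡ true
    eq (yes _)  = refl
    eq (no ¬Pv) = contradiction Pv ¬Pv

  ∈-subset⁻ : {P : Pred (Fin n) 0ℓ} (P? : Decidable P) {v : Fin n} → v ∈ₛ subset P? → P v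
  ∈-subset⁻ P? {v} v∈ =
    holds (P? v) (trans (sym (Vec.lookup∘tabulate (does ∘ P?) v)) (Vec.[]=⇒lookup v∈))
    where
    holds : ∀ d → does d ≡ true → _
    holds (yes Pv) _ = Pv

  relationMatrix : {R : Rel (Fin n) 0ℓ} → B.Decidable R → Matrix n
  relationMatrix R? = Vec.tabulate (λ u → subset (R? u))

  edge⁺ : {R : Rel (Fin n) 0ℓ} (R? : B.Decidable R) {u v : Fin n} → R u v → Edge (relationMatrix R?) u v
  edge⁺ R? {u} {v} Ruv =
    subst (v ∈ₛ_) (sym (Vec.lookup∘tabulate (λ u → subset (R? u)) u)) (∈-subset⁺ (R? u) Ruv)

  edge⁻ : {R : Rel (Fin n) 0ℓ} (R? : B.Decidable R) {u v : Fin n} → Edge (relationMatrix R?) u v → R u v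
  edge⁻ R? {u} {v} e =
    ∈-subset⁻ (R? u) (subst (v ∈ₛ_) (Vec.lookup∘tabulate (λ u → subset (R? u)) u) e)

subset-ext : ∀ {n} {S T : Subset n} → (∀ v → v ∈ₛ S → v ∈ₛ T) → (∀ v → v ∈ₛ T → v ∈ₛ S) → S ≡ T
subset-ext S⊆T T⊆S = ⊆-antisym (S⊆T _) (T⊆S _)

matrix-ext : ∀ {n} {M N : Matrix n} → (∀ u v → Edge M u v → Edge N u v) →
             (∀ u v → Edge N u v → Edge M u v) → M ≡ N
matrix-ext {n} {M} {N} M⊆N N⊆M = begin
  M                           ≡⟨ Vec.tabulate∘lookup M ⟨
  Vec.tabulate (Vec.lookup M) ≡⟨ Vec.tabulate-cong (λ u → subset-ext (M⊆N u) (N⊆M u)) ⟩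
  Vec.tabulate (Vec.lookup N) ≡⟨ Vec.tabulate∘lookup N ⟩
  N                           ∎
  where open ≡-Reasoning

elements : ∀ {n} → Subset n → List (Fin n)
elements S = filter (_∈ₛ? S) (allFin _)

length-elements : ∀ {n} (S : Subset n) → length (elements S) ≡ ∣ S ∣
length-elements [] = refl
length-elements {suc n} (b ∷ S) = first b
  where
  shift : ∀ {m} b (f : Fin m → Fin n) →
          length (filter (_∈ₛ? (b ∷ S)) (tabulate (suc ∘ f))) ≡ length (filter (_∈ₛ? S) (tabulate f))
  shift {zero}  b f = refl
  shift {suc m} b f with does (f zero ∈ₛ? S)
  ... | true  = cong suc (shift b (f ∘ suc))
  ... | false = shift b (f ∘ suc)
  first : ∀ b → length (elements (b ∷ S)) ≡ ∣ b ∷ S ∣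
  first true  = cong suc (trans (shift true id) (length-elements S))
  first false = trans (shift false id) (length-elements S)

-- The elements of `S` and the values of `f` are two duplicate-free lists with the same members.
-- This turns an indexing of the neighbours by ports into a degree.
∣∣-image : ∀ {n r} {S : Subset n} (f : Fin r → Fin n) → Injective _≡_ _≡_ f →
           (∀ v → v ∈ₛ S ⇔ (∃[ p ] f p ≡ v)) → ∣ S ∣ ≡ r
∣∣-image {n} {r} {S} f f-inj image = begin
  ∣ S ∣                 ≡⟨ length-elements S ⟨
  length (elements S)   ≡⟨ ℕ.≤-antisym
                             (length-⊆ (Unique.filter⁺ (_∈ₛ? S) (Unique.allFin⁺ n)) elements⊆)
                             (length-⊆ (Unique.tabulate⁺ f-inj) ⊆elements) ⟩
  length (tabulate f)   ≡⟨ List.length-tabulate f ⟩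
  r                     ∎
  where
  open ≡-Reasoning
  elements⊆ : ∀ {v} → v ∈ elements S → v ∈ tabulate f
  elements⊆ {v} v∈ with Equivalence.to (image v) (proj₂ (∈-filter⁻ (_∈ₛ? S) {xs = allFin n} v∈))
  ... | p , refl = ∈-tabulate⁺ p
  ⊆elements : ∀ {v} → v ∈ tabulate f → v ∈ elements S
  ⊆elements v∈ with ∈-tabulate⁻ v∈
  ... | p , refl = ∈-filter⁺ (_∈ₛ? S) (∈-allFin (f p)) (Equivalence.from (image (f p)) (p , refl))

-- Walks and loop erasure

-- The list omits the starting vertex, so its length is the number of steps.
data Walk {A : Set} (R : Rel A 0ℓ) : A → List A → A → Set where
  []  : ∀ {u} → Walk R u [] u
  _∷_ : ∀ {u w ws v} → R u w → Walk R w ws v → Walk R u (w ∷ ws) v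

mapWalk : ∀ {A B : Set} {R : Rel A 0ℓ} {Q : Rel B 0ℓ} (g : A → B) → (∀ {x y} → R x y → Q (g x) (g y)) →
          ∀ {u ws v} → Walk R u ws v → Walk Q (g u) (map g ws) (g v)
mapWalk g h []      = []
mapWalk g h (e ∷ w) = h e ∷ mapWalk g h w

relaxWalk : ∀ {A : Set} {R Q : Rel A 0ℓ} → (∀ {x y} → R x y → Q x y) →
            ∀ {u ws v} → Walk R u ws v → Walk Q u ws v
relaxWalk h []      = []
relaxWalk h (e ∷ w) = h e ∷ relaxWalk h w

walk⇒star : ∀ {A : Set} {R : Rel A 0ℓ} {u ws v} → Walk R u ws v → Star R u v
walk⇒star []      = ε
walk⇒star (e ∷ w) = e ◅ walk⇒star w

SimpleWalk : {A : Set} (R : Rel A 0ℓ) → A → List A → A → Set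
SimpleWalk R u ws v = Walk R u ws v × Unique (u ∷ ws)

simple-suffix : ∀ {A : Set} {R : Rel A 0ℓ} {u w ws v} → SimpleWalk R w ws v → u ∈ w ∷ ws →
                ∃[ ws′ ] SimpleWalk R u ws′ v
simple-suffix (walk     , uniq)     (here refl) = _ , walk , uniq
simple-suffix (e ∷ walk , _ ∷ uniq) (there u∈)  = simple-suffix (walk , uniq) u∈

module _ {n : ℕ} {R : Rel (Fin n) 0ℓ} where

  open import Data.List.Membership.DecPropositional {A = Fin n} Fin._≟_
    using () renaming (_∈?_ to _∈ₗ?_)

  -- Loop erasure: if the new first vertex already occurs, the walk is cut back to the suffix that
  -- starts there.
  star⇒simple : ∀ {u v} → Star R u v → ∃[ ws ] SimpleWalk R u ws v
  star⇒simple ε = [] , [] , [] ∷ []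
  star⇒simple {u} (_◅_ {j = w} e es) with star⇒simple es
  ... | ws , walk , uniq with u ∈ₗ? (w ∷ ws)
  ... | yes u∈ = simple-suffix (walk , uniq) u∈
  ... | no  u∉ = w ∷ ws , e ∷ walk , All.¬Any⇒All¬ _ u∉ ∷ uniq

  walk-lookup : ∀ {u ws v} → Walk R u ws v → ∀ i j → suc (toℕ i) ≡ toℕ j →
                R (lookup (u ∷ ws) i) (lookup (u ∷ ws) j)
  walk-lookup []      zero    zero           ()
  walk-lookup (e ∷ w) zero    (suc zero)     _  = e
  walk-lookup (e ∷ w) zero    (suc (suc _))  ()
  walk-lookup (e ∷ w) (suc i) (suc j)        eq = walk-lookup w i j (ℕ.suc-injective eq)
  walk-lookup []      (suc ()) _             _

  walk-last : ∀ {u ws v} → Walk R u ws v → lookup (u ∷ ws) (Fin.fromℕ (length ws)) ≡ v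
  walk-last []      = refl
  walk-last (e ∷ w) = walk-last w

  tabulate-walk : ∀ {k} (f : Fin (suc k) → Fin n) → (∀ i j → suc (toℕ i) ≡ toℕ j → R (f i) (f j)) →
                  Walk R (f zero) (tabulate (f ∘ suc)) (f (Fin.fromℕ k))
  tabulate-walk {zero}  f adj = []
  tabulate-walk {suc k} f adj =
    adj zero (suc zero) refl ∷ tabulate-walk (f ∘ suc) (λ i j eq → adj (suc i) (suc j) (cong suc eq))

does-≡ : {P Q : Set} (p? : Dec P) (q? : Dec Q) → does p? ≡ does q? → (P × Q) ⊎ (¬ P × ¬ Q)
does-≡ (yes p) (yes q) _ = inj₁ (p , q)
does-≡ (no ¬p) (no ¬q) _ = inj₂ (¬p , ¬q)

lookup-injective : {A : Set} {xs : List A} → Unique xs → ∀ {i j} → lookup xs i ≡ lookup xs j → i ≡ j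
lookup-injective (x∉ ∷ _) {zero}  {zero}  _  = refl
lookup-injective (x∉ ∷ _) {zero}  {suc j} eq = contradiction eq (All.lookup x∉ (∈-lookup j))
lookup-injective (x∉ ∷ _) {suc i} {zero}  eq = contradiction (sym eq) (All.lookup x∉ (∈-lookup i))
lookup-injective (_ ∷ u)  {suc i} {suc j} eq = cong suc (lookup-injective u eq)

tabulate-injective : {A : Set} {k : ℕ} {f g : Fin k → A} → tabulate f ≡ tabulate g → f ≗ g
tabulate-injective eq zero    = List.∷-injectiveˡ eq
tabulate-injective eq (suc i) = tabulate-injective (List.∷-injectiveʳ eq) i

unique⇒length≤ : ∀ {n} {ws : List (Fin n)} → Unique ws → length ws ≤ n
unique⇒length≤ {n} {ws} uniq =
  subst (length ws ≤_) (List.length-tabulate {n = n} id) (length-⊆ uniq (λ {x} _ → ∈-allFin x))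

-- Path subgraphs, the walks that spell them and their ends

module _ {n : ℕ} (G : Graph n) where

  Candidate : Set
  Candidate = Subset n × Matrix n

  IsPath : ℕ × Candidate → Set
  IsPath (i , H) = IsPathSubgraph G (suc i) H

  isPath? : Decidable IsPath
  isPath? (i , H) = isPathSubgraph? G (suc i) H

  paths : List (ℕ × Candidate)
  paths = filter isPath? (cartesianProduct (upTo n) (candidates n))

  pn≡length-paths : pn G ≡ length paths
  pn≡length-paths = sum-length-filter (λ i → isPathSubgraph? G (suc i)) (upTo n) (candidates n)

  paths-unique : Unique paths
  paths-unique = Unique.filter⁺ isPath? (Unique.cartesianProduct⁺ (Unique.upTo⁺ n) (candidates-unique n))

  ∈-paths⁺ : ∀ {i H} → i < n → IsPathSubgraph G (suc i) H → (i , H) ∈ paths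
  ∈-paths⁺ i<n p = ∈-filter⁺ isPath? (∈-cartesianProduct⁺ (∈-upTo⁺ i<n) (∈-candidates _)) p

  ∈-paths⁻ : ∀ {p} → p ∈ paths → IsPath p
  ∈-paths⁻ p∈ = proj₂ (∈-filter⁻ isPath? {xs = cartesianProduct (upTo n) (candidates n)} p∈)

  -- The vertex set is the image of the isomorphism. By `IsSubgraph` an edge has both ends in that
  -- set, so the edges too are read off from positions.
  isomorphism-determines : ∀ {k} {H H′ : Candidate} {f g : Fin k → Fin n} →
    IsSubgraph G H → IsSubgraph G H′ →
    IsIsomorphism (PathAdj k) H f → IsIsomorphism (PathAdj k) H′ g → f ≗ g → H ≡ H′
  isomorphism-determines {k} {H} {H′} {f} {g} sub sub′ iso iso′ f≗g =
    cong₂ _,_ (subset-ext (vertices H H′ iso iso′ f≗g) (vertices H′ H iso′ iso (sym ∘ f≗g)))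
              (matrix-ext (edges H H′ sub iso iso′ f≗g) (edges H′ H sub′ iso′ iso (sym ∘ f≗g)))
    where
    vertices : ∀ H H′ {f g} → IsIsomorphism (PathAdj k) H f → IsIsomorphism (PathAdj k) H′ g → f ≗ g →
               ∀ v → v ∈ₛ proj₁ H → v ∈ₛ proj₁ H′
    vertices _ _ (_ , onto , _) (_ , onto′ , _) f≗g v v∈ with Equivalence.to (onto v) v∈
    ... | i , refl = Equivalence.from (onto′ v) (i , sym (f≗g i))
    edges : ∀ H H′ {f g} → IsSubgraph G H →
            IsIsomorphism (PathAdj k) H f → IsIsomorphism (PathAdj k) H′ g → f ≗ g →
            ∀ u v → Edge (proj₂ H) u v → Edge (proj₂ H′) u v
    edges _ H′ (_ , sub) (_ , onto , adj) (_ , _ , adj′) f≗g u v e with sub u v e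
    ... | u∈ , v∈ , _ with Equivalence.to (onto u) u∈ | Equivalence.to (onto v) v∈
    ... | i , refl | j , refl =
      subst₂ (Edge (proj₂ H′)) (sym (f≗g i)) (sym (f≗g j))
             (Equivalence.to (adj′ i j) (Equivalence.from (adj i j) e))

  -- A path is spelled once in each direction; the upper bound only needs that a word spells at most
  -- one path.
  Spells : ℕ × Candidate → List (Fin n) → Set
  Spells (i , H) ws = IsSubgraph G H ×
    ∃[ f ] IsIsomorphism (PathAdj (suc i)) H f × tabulate f ≡ ws

  spells-injective : ∀ {p q ws} → Spells p ws → Spells q ws → p ≡ q
  spells-injective {i , _} {j , _} (sub , f , iso , refl) (sub′ , g , iso′ , eq)
    with ℕ.suc-injective (trans (sym (List.length-tabulate f))
                                (trans (cong length (sym eq)) (List.length-tabulate g)))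
  ... | refl =
    cong (i ,_) (isomorphism-determines sub sub′ iso iso′ (tabulate-injective (sym eq)))

  pn-≤ : (ys : List (List (Fin n))) → (∀ {u ws v} → SimpleWalk (Adj G) u ws v → u ∷ ws ∈ ys) →
         pn G ≤ length ys
  pn-≤ ys complete = subst (_≤ length ys) (sym pn≡length-paths)
    (length-≤ Spells paths-unique spelling (λ {x} {x′} → spells-injective {x} {x′}))
    where
    spelling : ∀ {p} → p ∈ paths → ∃[ ws ] ws ∈ ys × Spells p ws
    spelling {p} p∈ with ∈-paths⁻ p∈
    ... | sub , f , iso@(inj , onto , adj) =
      tabulate f , complete (tabulate-walk f step , Unique.tabulate⁺ inj) , sub , f , iso , refl
      where
      step : ∀ i j → suc (toℕ i) ≡ toℕ j → Adj G (f i) (f j)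
      step i j eq = proj₂ (proj₂ (proj₂ sub _ _ (Equivalence.to (adj i j) (inj₁ eq))))

  -- Intrinsic to the subgraph, so independent of the chosen isomorphism. Asking for at most one
  -- neighbour covers the path with a single vertex.
  IsEnd : Candidate → Fin n → Set
  IsEnd (S , M) v = v ∈ₛ S × (∀ x y → Edge M v x → Edge M v y → x ≡ y)

  module _ {k : ℕ} (H : Candidate) {f : Fin (suc k) → Fin n}
           (sub : IsSubgraph G H) (iso : IsIsomorphism (PathAdj (suc k)) H f) where

    private
      inj  = proj₁ iso
      onto = proj₁ (proj₂ iso)
      adj  = proj₂ (proj₂ iso)

    neighbour : ∀ i x → Edge (proj₂ H) (f i) x → ∃[ j ] f j ≡ x × PathAdj (suc k) i j
    neighbour i x e with Equivalence.to (onto x) (proj₁ (proj₂ (proj₂ sub (f i) x e)))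
    ... | j , refl = j , refl , Equivalence.from (adj i j) e

    unique-neighbour⇒isEnd : ∀ i (m : ℕ) → (∀ j → PathAdj (suc k) i j → toℕ j ≡ m) → IsEnd H (f i)
    unique-neighbour⇒isEnd i m only = Equivalence.from (onto (f i)) (i , refl) , same
      where
      same : ∀ x y → Edge (proj₂ H) (f i) x → Edge (proj₂ H) (f i) y → x ≡ y
      same x y ex ey with neighbour i x ex | neighbour i y ey
      ... | j , refl , ij | j′ , refl , ij′ =
        cong f (Fin.toℕ-injective (trans (only j ij) (sym (only j′ ij′))))

    first-isEnd : IsEnd H (f zero)
    first-isEnd = unique-neighbour⇒isEnd zero 1 λ { j (inj₁ eq) → sym eq ; j (inj₂ ()) }

    last-isEnd : IsEnd H (f (Fin.fromℕ k))
    -- For `k` = 0 there is no neighbour, and the value of `pred` at 0 is a mere default.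
    last-isEnd = unique-neighbour⇒isEnd (Fin.fromℕ k) (ℕ.pred k) only
      where
      only : ∀ j → PathAdj (suc k) (Fin.fromℕ k) j → toℕ j ≡ ℕ.pred k
      only j (inj₁ eq) = contradiction (Fin.toℕ<n j)
        (ℕ.<-irrefl (trans (sym eq) (cong suc (Fin.toℕ-fromℕ k))))
      only j (inj₂ eq) = cong ℕ.pred (trans eq (Fin.toℕ-fromℕ k))

    -- An inner position has a predecessor and a successor, which injectivity keeps apart.
    isEnd⇒ : ∀ {v} → IsEnd H v → v ≡ f zero ⊎ v ≡ f (Fin.fromℕ k)
    isEnd⇒ {v} (v∈ , same) with Equivalence.to (onto v) v∈
    ... | zero  , refl = inj₁ refl
    ... | suc i , refl with suc (toℕ i) ℕ.<? k
    ... | no ≮k = inj₂ (cong f (Fin.toℕ-injective (trans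
            (ℕ.≤-antisym (ℕ.≤-pred (Fin.toℕ<n (suc i))) (ℕ.≮⇒≥ ≮k)) (sym (Fin.toℕ-fromℕ k)))))
    ... | yes <k = contradiction
            (trans (sym (Fin.toℕ-inject₁ i))
              (trans (cong toℕ (inj (same (f (inject₁ i)) (f next) edge₁ edge₂)))
                     (Fin.toℕ-fromℕ< (s≤s <k))))
            (ℕ.<⇒≢ (ℕ.m≤n⇒m≤1+n ℕ.≤-refl))
      where
      next : Fin (suc k)
      next = fromℕ< (s≤s <k)
      edge₁ = Equivalence.to (adj (suc i) (inject₁ i)) (inj₂ (cong suc (Fin.toℕ-inject₁ i)))
      edge₂ = Equivalence.to (adj (suc i) next) (inj₁ (sym (Fin.toℕ-fromℕ< (s≤s <k))))

  -- The Boolean records the order of the ends, which the path alone does not determine.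
  Joins : Fin n × Fin n → (ℕ × Candidate) × Bool → Set
  Joins (u , v) ((i , H) , b) = IsSubgraph G H × (∃[ f ] IsIsomorphism (PathAdj (suc i)) H f ×
    f zero ≡ u × f (Fin.fromℕ i) ≡ v) × b ≡ does (toℕ u ℕ.≤? toℕ v)

  -- Two isomorphisms onto the same path have the same ends up to order. If the order is reversed,
  -- equal Booleans compare u with v as they compare v with u, which forces u = v.
  joins-injective : ∀ {p q y} → Joins p y → Joins q y → p ≡ q
  joins-injective {y = (_ , H) , _}
    (sub , (f , iso , refl , refl) , refl) (_ , (g , iso′ , refl , refl) , orient)
    with isEnd⇒ H sub iso (first-isEnd H sub iso′) | isEnd⇒ H sub iso (last-isEnd H sub iso′)
       | isEnd⇒ H sub iso′ (first-isEnd H sub iso) | isEnd⇒ H sub iso′ (last-isEnd H sub iso)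
  ... | inj₁ a | inj₂ b | _ | _ = sym (cong₂ _,_ a b)
  ... | inj₂ a | inj₁ b | _ | _ = swapped (sym b) (sym a) orient
    where
    swapped : ∀ {u v u′ v′ : Fin n} → u ≡ v′ → v ≡ u′ →
              does (toℕ u ℕ.≤? toℕ v) ≡ does (toℕ u′ ℕ.≤? toℕ v′) → (u , v) ≡ (u′ , v′)
    swapped {u} {v} refl refl eq with does-≡ (toℕ u ℕ.≤? toℕ v) (toℕ v ℕ.≤? toℕ u) eq
    ... | inj₁ (p , q) = cong₂ _,_ (Fin.toℕ-injective (ℕ.≤-antisym p q))
                                   (Fin.toℕ-injective (ℕ.≤-antisym q p))
    ... | inj₂ (p , q) = contradiction (ℕ.≰⇒≥ p) q
  -- In the remaining cases both ends of `g` coincide with one end of `f`; the comparison in the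
  -- other direction then makes all four ends equal.
  ... | inj₁ a | inj₁ b | _ | inj₁ d = sym (cong₂ _,_ a (trans b (trans (sym a) (sym d))))
  ... | inj₁ a | inj₁ b | _ | inj₂ d = sym (cong₂ _,_ a (sym d))
  ... | inj₂ a | inj₂ b | inj₁ c | _ = sym (cong₂ _,_ (sym c) b)
  ... | inj₂ a | inj₂ b | inj₂ c | _ = sym (cong₂ _,_ (trans a (trans (sym b) (sym c))) b)

  module _ {k : ℕ} (f : Fin (suc k) → Fin n) where

    InImage : Pred (Fin n) 0ℓ
    InImage v = ∃[ i ] f i ≡ v

    ImageEdge : Rel (Fin n) 0ℓ
    ImageEdge u v = ∃[ i ] ∃[ j ] PathAdj (suc k) i j × f i ≡ u × f j ≡ v

    inImage? : Decidable InImage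
    inImage? v = Fin.any? λ i → f i Fin.≟ v

    imageEdge? : B.Decidable ImageEdge
    imageEdge? u v = Fin.any? λ i → Fin.any? λ j →
      pathAdj? (suc k) i j ×-dec f i Fin.≟ u ×-dec f j Fin.≟ v

    pathImage : Candidate
    pathImage = subset inImage? , relationMatrix imageEdge?

    pathAdj-swap : ∀ {i j} → PathAdj (suc k) i j → PathAdj (suc k) j i
    pathAdj-swap (inj₁ eq) = inj₂ eq
    pathAdj-swap (inj₂ eq) = inj₁ eq

    pathImage-isSubgraph : (∀ i j → suc (toℕ i) ≡ toℕ j → Adj G (f i) (f j)) → IsSubgraph G pathImage
    pathImage-isSubgraph step = sym′ , inside
      where
      sym′ : B.Symmetric (Edge (proj₂ pathImage))
      sym′ e with edge⁻ imageEdge? e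
      ... | i , j , ij , eq , eq′ = edge⁺ imageEdge? (j , i , pathAdj-swap ij , eq′ , eq)
      adjacent : ∀ i j → PathAdj (suc k) i j → Adj G (f i) (f j)
      adjacent i j (inj₁ eq) = step i j eq
      adjacent i j (inj₂ eq) = symmetric G (step j i eq)
      inside : ∀ u v → Edge (proj₂ pathImage) u v →
               u ∈ₛ proj₁ pathImage × v ∈ₛ proj₁ pathImage × Adj G u v
      inside u v e with edge⁻ imageEdge? e
      ... | i , j , ij , refl , refl =
        ∈-subset⁺ inImage? (i , refl) , ∈-subset⁺ inImage? (j , refl) , adjacent i j ij

    pathImage-isomorphism : Injective _≡_ _≡_ f → IsIsomorphism (PathAdj (suc k)) pathImage f
    pathImage-isomorphism inj =
      inj , (λ v → mk⇔ (∈-subset⁻ inImage?) (∈-subset⁺ inImage?)) ,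
      λ i j → mk⇔ (λ ij → edge⁺ imageEdge? (i , j , ij , refl , refl)) (back i j)
      where
      back : ∀ i j → Edge (proj₂ pathImage) (f i) (f j) → PathAdj (suc k) i j
      back i j e with edge⁻ imageEdge? e
      ... | i′ , j′ , ij , eq , eq′ = subst₂ (PathAdj (suc k)) (inj eq) (inj eq′) ij

  n²≤2pn : Connected G → n * n ≤ 2 * pn G
  n²≤2pn conn = begin
    n * n
      ≡⟨ cong₂ _*_ (List.length-tabulate {n = n} id) (List.length-tabulate {n = n} id) ⟨
    length (allFin n) * length (allFin n)
      ≡⟨ length-cartesianProductWith _,_ (allFin n) (allFin n) ⟨
    length (cartesianProduct (allFin n) (allFin n))
      ≤⟨ length-≤ Joins (Unique.cartesianProduct⁺ (Unique.allFin⁺ n) (Unique.allFin⁺ n))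
                  (λ {x} _ → joining x) (λ {x} {x′} {y} → joins-injective {x} {x′} {y}) ⟩
    length (cartesianProduct paths (true ∷ false ∷ []))
      ≡⟨ length-cartesianProductWith _,_ paths (true ∷ false ∷ []) ⟩
    length paths * 2
      ≡⟨ ℕ.*-comm (length paths) 2 ⟩
    2 * length paths
      ≡⟨ cong (2 *_) pn≡length-paths ⟨
    2 * pn G ∎
    where
    open ℕ.≤-Reasoning
    bool∈ : ∀ b → b ∈ true ∷ false ∷ []
    bool∈ true  = here refl
    bool∈ false = there (here refl)
    joining : ∀ x → ∃[ y ] y ∈ cartesianProduct paths (true ∷ false ∷ []) × Joins x y
    joining (u , v) with star⇒simple (conn u v)
    ... | ws , walk , uniq =
      ((length ws , pathImage f) , does (toℕ u ℕ.≤? toℕ v)) ,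
      ∈-cartesianProduct⁺ (∈-paths⁺ (unique⇒length≤ uniq) (sub , f , iso)) (bool∈ _) ,
      sub , (f , iso , refl , walk-last walk) , refl
      where
      f = lookup (u ∷ ws)
      sub = pathImage-isSubgraph f (walk-lookup walk)
      iso = pathImage-isomorphism f (lookup-injective uniq)

-- Deciding which path numbers occur

module _ {n : ℕ} {R : Rel (Fin n) 0ℓ} (R? : B.Decidable R) where

  walk? : ∀ u ws v → Dec (Walk R u ws v)
  walk? u []       v = map′ (λ { refl → [] }) (λ { [] → refl }) (u Fin.≟ v)
  walk? u (w ∷ ws) v = map′ (λ (e , p) → e ∷ p) (λ { (e ∷ p) → e , p }) (R? u w ×-dec walk? w ws v)

  -- By loop erasure it suffices to try words of length at most `n`.
  star? : B.Decidable (Star R)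
  star? u v = map′ (λ found → walk⇒star (proj₂ (Any.satisfied found))) short
                   (Any.any? (λ ws → walk? u ws v) (listsUpTo (allFin n) n))
    where
    short : Star R u v → Any (λ ws → Walk R u ws v) (listsUpTo (allFin n) n)
    short es with star⇒simple es
    ... | ws , walk , _ ∷ uniq =
      lose (∈-listsUpTo (unique⇒length≤ uniq) (All.tabulate (λ {w} _ → ∈-allFin w))) walk

module _ {r n : ℕ} where

  HasMatrix : ℕ → Matrix n → Set
  HasMatrix m M = ∃[ G ] matrix G ≡ M × Connected G × Regular r G × pn G ≡ m

  hasMatrix? : ∀ m M → Dec (HasMatrix m M)
  hasMatrix? m M
    with Fin.all? (λ u → Fin.all? λ v → edge? M u v →-dec edge? M v u)
       | Fin.all? (λ u → ¬? (edge? M u u))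
  ... | no ¬sym | _      = no λ { (G , refl , _) → ¬sym (λ u v → symmetric G) }
  ... | yes _   | no ¬irr = no λ { (G , refl , _) → ¬irr (λ u → irreflexive G refl) }
  ... | yes sym′ | yes irr =
    -- `Connected`, `Regular` and `pn` read only the matrix, so evidence for any graph with this
    -- matrix serves for the rebuilt one.
    map′ (λ p → G , refl , p) (λ { (_ , refl , p) → p })
         (Fin.all? (λ u → Fin.all? λ v → star? (edge? M) u v) ×-dec
          Fin.all? (λ u → degree G u ℕ.≟ r) ×-dec pn G ℕ.≟ m)
    where
    G : Graph n
    G = record { matrix      = M
               ; symmetric   = λ {u} {v} → sym′ u v
               ; irreflexive = λ { {u} refl → irr u } }

  -- An inhabited set of numbers yields its minimum constructively once membership is decidable;
  -- here finitely many matrices are searched.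
  pathNumbers? : Decidable (PathNumbers r n)
  pathNumbers? m = map′
    found
    (λ (G , p) → lose (∈-vectors ∈-subsets (matrix G)) (G , refl , p))
    (Any.any? (hasMatrix? m) (vectors (subsets n) n))
    where
    found : Any (HasMatrix m) (vectors (subsets n) n) → PathNumbers r n m
    found any with Any.satisfied any
    ... | _ , G , _ , p = G , p

module _ {P : Pred ℕ 0ℓ} (P? : Decidable P) where

  minimum : ∀ m → P m → ∃[ k ] IsMinimum P k
  minimum = <-rec _ descend
    where
    descend : ∀ m → (∀ {k} → k < m → P k → ∃[ l ] IsMinimum P l) → P m → ∃[ l ] IsMinimum P l
    descend m rec Pm with ℕ.anyUpTo? P? m
    ... | yes (k , k<m , Pk) = rec k<m Pk
    ... | no none            = m , Pm , λ k Pk → ℕ.≮⇒≥ (λ k<m → none (k , k<m , Pk))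

-- Regular graphs given by ports

-- Regularity is built in: the neighbours of a vertex correspond to the ports in P.
record PortGraph (V P : Set) : Set where
  field
    nbr           : V → P → V
    nbr-injective : ∀ u {p q} → nbr u p ≡ nbr u q → p ≡ q
    back          : ∀ u p → ∃[ q ] nbr (nbr u p) q ≡ u
    loopless      : ∀ u p → nbr u p ≢ u

  infix 4 _~_
  _~_ : Rel V 0ℓ
  u ~ v = ∃[ p ] nbr u p ≡ v

  ~-sym : B.Symmetric _~_
  ~-sym {u} (p , refl) = back u p

module _ {A B : Set} (A↔B : A ↔ B) where

  open Inverse A↔B

  to-injective : Injective _≡_ _≡_ to
  to-injective eq = trans (sym (strictlyInverseʳ _)) (trans (cong from eq) (strictlyInverseʳ _))

  from-injective : Injective _≡_ _≡_ from
  from-injective eq = trans (sym (strictlyInverseˡ _)) (trans (cong to eq) (strictlyInverseˡ _))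

module Realise {V P : Set} {n r : ℕ} (V↔ : V ↔ Fin n) (P↔ : P ↔ Fin r) (Γ : PortGraph V P) where

  open PortGraph Γ
  private
    module V = Inverse V↔
    module P = Inverse P↔

  _≈_ : Rel (Fin n) 0ℓ
  u ≈ v = ∃[ p ] V.to (nbr (V.from u) (P.from p)) ≡ v

  _≈?_ : B.Decidable _≈_
  u ≈? v = Fin.any? λ p → V.to (nbr (V.from u) (P.from p)) Fin.≟ v

  ≈⇒~ : ∀ {u v} → u ≈ v → V.from u ~ V.from v
  ≈⇒~ (p , refl) = P.from p , sym (V.strictlyInverseʳ _)

  ~⇒≈ : ∀ {u v} → V.from u ~ V.from v → u ≈ v
  ~⇒≈ (p , eq) = P.to p , trans (cong (V.to ∘ nbr _) (P.strictlyInverseʳ p))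
                                (trans (cong V.to eq) (V.strictlyInverseˡ _))

  graph : Graph n
  graph = record
    { matrix      = relationMatrix _≈?_
    ; symmetric   = λ e → edge⁺ _≈?_ (~⇒≈ (~-sym (≈⇒~ (edge⁻ _≈?_ e))))
    ; irreflexive = λ { {u} refl e → let p , eq = ≈⇒~ (edge⁻ _≈?_ e) in loopless (V.from u) p eq }
    }

  adj⇒~ : ∀ {u v} → Adj graph u v → V.from u ~ V.from v
  adj⇒~ e = ≈⇒~ (edge⁻ _≈?_ e)

  regular : Regular r graph
  regular u = ∣∣-image (λ p → V.to (nbr (V.from u) (P.from p)))
    (λ eq → from-injective P↔ (nbr-injective (V.from u) (to-injective V↔ eq)))
    (λ v → mk⇔ (edge⁻ _≈?_) (edge⁺ _≈?_))

  connected : (∀ u v → Star _~_ u v) → Connected graph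
  connected conn u v = subst₂ (Star (Adj graph)) (V.strictlyInverseˡ u) (V.strictlyInverseˡ v)
    (Star.gmap V.to lift (conn (V.from u) (V.from v)))
    where
    lift : ∀ {x y} → x ~ y → Adj graph (V.to x) (V.to y)
    lift x~y = edge⁺ _≈?_
      (~⇒≈ (subst₂ _~_ (sym (V.strictlyInverseʳ _)) (sym (V.strictlyInverseʳ _)) x~y))

  -- The length bound is passed on so that `ys` may be generated by recursion on `n`.
  pn-graph-≤ : (ys : List (List V)) →
               (∀ {u ws v} → SimpleWalk _~_ u ws v → length ws ≤ n → u ∷ ws ∈ ys) →
               pn graph ≤ length ys
  pn-graph-≤ ys complete = subst (pn graph ≤_) (List.length-map (map V.to) ys)
    (pn-≤ graph (map (map V.to) ys) found)
    where
    found : ∀ {u ws v} → SimpleWalk (Adj graph) u ws v → u ∷ ws ∈ map (map V.to) ys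
    found {u} {ws} (walk , uniq) = subst (_∈ map (map V.to) ys) roundtrip
      (∈-map⁺ (map V.to) (complete
        (mapWalk V.from adj⇒~ walk , Unique.map⁺ (from-injective V↔) uniq)
        (subst (_≤ n) (sym (List.length-map V.from ws))
          (ℕ.≤-trans (ℕ.n≤1+n _) (unique⇒length≤ uniq)))))
      where
      roundtrip : map V.to (map V.from (u ∷ ws)) ≡ u ∷ ws
      roundtrip = trans (sym (List.map-∘ (u ∷ ws)))
                        (trans (List.map-cong V.strictlyInverseˡ (u ∷ ws)) (List.map-id (u ∷ ws)))

-- A crude bound that depends on the order alone, enough for graphs of bounded order.
pn≤numLists : ∀ {n b} (G : Graph n) → n ≤ b → pn G ≤ numLists b b
pn≤numLists {n} {b} G n≤b = ℕ.≤-trans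
  (pn-≤ G (listsUpTo (allFin n) b)
    (λ (_ , uniq) → ∈-listsUpTo (ℕ.≤-trans (unique⇒length≤ uniq) n≤b)
                                (All.tabulate (λ {w} _ → ∈-allFin w))))
  (length-listsUpTo b (ℕ.≤-trans (ℕ.≤-reflexive (List.length-tabulate {n = n} id)) n≤b))

-- Simple walks on a ring of beads

module Bracelet {m : ℕ} (size : Fin m → ℕ) (root : ∀ i → Fin (size i))
                (turn : Bool → Fin m → Fin m) (turn-inverse : ∀ d i → turn (not d) (turn d i) ≡ i) where

  Bead : Set
  Bead = ∃[ i ] Fin (size i)

  rootOf : Fin m → Bead
  rootOf i = i , root i

  -- Coarser than adjacency in the necklace: inside a bead any two vertices are related, because
  -- only the bead's size enters the count.
  data Step : Rel Bead 0ℓ where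
    within : ∀ {i x y} → Step (i , x) (i , y)
    hop    : ∀ d {i} → Step (rootOf i) (rootOf (turn d i))

  bead : Fin m → List Bead
  bead i = map (i ,_) (allFin (size i))

  InBead : Fin m → List Bead → Set
  InBead i = All (_∈ bead i)

  ∈-bead : ∀ {i} x → (i , x) ∈ bead i
  ∈-bead {i} x = ∈-map⁺ (i ,_) (∈-allFin x)

  length-bead : ∀ i → length (bead i) ≡ size i
  length-bead i = trans (List.length-map {B = Bead} (i ,_) (allFin (size i)))
                        (List.length-tabulate {n = size i} id)

  -- Each bead is left only through its root, so a simple walk that has used the root stays inside.
  confined : ∀ {i x ws v} → Walk Step (i , x) ws v → rootOf i ∉ (i , x) ∷ ws → InBead i ws
  confined []                      _      = []
  confined (within {y = y} ∷ walk) avoids = ∈-bead y ∷ confined walk (avoids ∘ there)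
  confined (hop d ∷ walk)          avoids = contradiction (here refl) avoids

  module _ {b : ℕ} (size≤b : ∀ i → size i ≤ b) where

    -- A word without repetition is no longer than the bead it lives in, so `b` bounds both the
    -- alphabet and the length.
    inside : Fin m → List (List Bead)
    inside i = listsUpTo (bead i) b

    ∈-inside : ∀ {i ws} → Unique ws → InBead i ws → ws ∈ inside i
    ∈-inside {i} {ws} uniq in-i = ∈-listsUpTo (ℕ.≤-trans (length-⊆ uniq (All.lookup in-i))
      (ℕ.≤-trans (ℕ.≤-reflexive (length-bead i)) (size≤b i))) in-i

    -- Candidates for walks that enter bead `i` at its root in direction `d`: either the walk stays,
    -- or it moves on at once and leaves only the root in its trace. The number is fuel.
    arcs : Bool → ℕ → Fin m → List (List Bead)
    arcs d zero    i = inside i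
    arcs d (suc k) i = inside i ++ map (rootOf i ∷_) (arcs d k (turn d i))

    inside⇒arcs : ∀ {d i ws} k → ws ∈ inside i → ws ∈ arcs d k i
    inside⇒arcs zero    = id
    inside⇒arcs (suc k) = ∈-++⁺ˡ

    -- The root the walk came from is excluded, so a hop cannot reverse direction. After the hop the
    -- excluded root is that of `i`, which simplicity already forbids.
    ∈-arcs : ∀ {d i ws v} k → SimpleWalk Step (rootOf i) ws v → rootOf (turn (not d) i) ∉ ws →
             length ws ≤ k → rootOf i ∷ ws ∈ arcs d k i
    ∈-arcs {d} k ([] , uniq) _ _ = inside⇒arcs {d} k (∈-inside uniq (∈-bead _ ∷ []))
    ∈-arcs {d} k (within {y = y} ∷ walk , uniq@(root∉ ∷ _)) _ _ =
      inside⇒arcs {d} k (∈-inside uniq (∈-bead _ ∷ ∈-bead y ∷ confined walk (All.All¬⇒¬Any root∉)))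
    ∈-arcs {d} {i} (suc k) (hop d′ ∷ walk , root∉@(_ ∷ root∉ws) ∷ uniq) avoids (s≤s l)
      with d′ Bool.≟ d
    ... | no d′≢d  =
      contradiction (here (cong (λ e → rootOf (turn e i)) (sym (Bool.¬-not d′≢d)))) avoids
    ... | yes refl = ∈-++⁺ʳ (inside i) (∈-map⁺ (rootOf i ∷_)
      (∈-arcs k (walk , uniq)
        (subst (λ j → rootOf j ∉ _) (sym (turn-inverse d i)) (All.All¬⇒¬Any root∉ws)) l))

    tails : ℕ → Fin m → List (List Bead)
    tails k i = [] ∷ arcs true k (turn true i) ++ arcs false k (turn false i)

    walksFrom : ℕ → Fin m → List (List Bead)
    walksFrom k i = cartesianProductWith _++_ (inside i) (tails k i)

    simpleWalks : ℕ → List (List Bead)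
    simpleWalks k = concatMap (walksFrom k) (allFin m)

    arc⇒tail : ∀ d k i {ws} → ws ∈ arcs d k (turn d i) → ws ∈ tails k i
    arc⇒tail true  k i ws∈ = there (∈-++⁺ˡ ws∈)
    arc⇒tail false k i ws∈ = there (∈-++⁺ʳ (arcs true k (turn true i)) ws∈)

    -- The cut is made at the first hop. The rest begins at a neighbouring root and avoids the root
    -- just left, as `∈-arcs` requires.
    split-walk : ∀ {i x ws v} k → SimpleWalk Step (i , x) ws v → length ws ≤ k →
                 ∃[ ps ] ∃[ qs ] (i , x) ∷ ws ≡ ps ++ qs × Unique ps × InBead i ps × qs ∈ tails k i
    split-walk k ([] , uniq) _ = _ , [] , refl , uniq , ∈-bead _ ∷ [] , here refl
    split-walk (suc k) (within ∷ walk , x∉ ∷ uniq) (s≤s l)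
      -- The fuel is kept because `tails` depends on it; the recursion is on the walk.
      with split-walk (suc k) (walk , uniq) (ℕ.m≤n⇒m≤1+n l)
    ... | ps , qs , eq , uniq-ps , in-ps , qs∈ =
      _ ∷ ps , qs , cong (_ ∷_) eq ,
      All.++⁻ˡ ps (subst (All (_ ≢_)) eq x∉) ∷ uniq-ps , ∈-bead _ ∷ in-ps , qs∈
    split-walk {i} (suc k) (hop d ∷ walk , (_ ∷ root∉ws) ∷ uniq) (s≤s l) =
      rootOf i ∷ [] , _ , refl , [] ∷ [] , ∈-bead _ ∷ [] ,
      arc⇒tail d (suc k) i (∈-arcs (suc k) (walk , uniq)
        (subst (λ j → rootOf j ∉ _) (sym (turn-inverse d i)) (All.All¬⇒¬Any root∉ws))
        (ℕ.m≤n⇒m≤1+n l))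

    ∈-simpleWalks : ∀ {u ws v} k → SimpleWalk Step u ws v → length ws ≤ k → u ∷ ws ∈ simpleWalks k
    ∈-simpleWalks {i , x} k walk l with split-walk k walk l
    ... | ps , qs , eq , uniq , in-ps , qs∈ =
      ∈-concatMap⁺ (walksFrom k) (lose (∈-allFin i)
        (subst (_∈ walksFrom k i) (sym eq) (∈-cartesianProductWith⁺ _++_ (∈-inside uniq in-ps) qs∈)))

    private
      K = numLists b b

    length-inside : ∀ i → length (inside i) ≤ K
    length-inside i = length-listsUpTo b (ℕ.≤-trans (ℕ.≤-reflexive (length-bead i)) (size≤b i))

    -- Linear in `k`: passing a bead involves no choice, so the counts for the possible last beads
    -- add up instead of multiplying.
    length-arcs : ∀ d k i → length (arcs d k i) ≤ suc k * K
    length-arcs d zero    i = ℕ.≤-trans (length-inside i) (ℕ.≤-reflexive (sym (ℕ.+-identityʳ K)))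
    length-arcs d (suc k) i = begin
      length (inside i ++ map (rootOf i ∷_) (arcs d k (turn d i)))
        ≡⟨ List.length-++ (inside i) ⟩
      length (inside i) + length (map (rootOf i ∷_) (arcs d k (turn d i)))
        ≡⟨ cong (length (inside i) +_) (List.length-map (rootOf i ∷_) (arcs d k (turn d i))) ⟩
      length (inside i) + length (arcs d k (turn d i))
        ≤⟨ ℕ.+-mono-≤ (length-inside i) (length-arcs d k (turn d i)) ⟩
      suc (suc k) * K ∎
      where open ℕ.≤-Reasoning

    length-tails : ∀ k i → length (tails k i) ≤ suc (suc k * K + suc k * K)
    length-tails k i = s≤s (begin
      length (arcs true k (turn true i) ++ arcs false k (turn false i))
        ≡⟨ List.length-++ (arcs true k (turn true i)) ⟩
      length (arcs true k (turn true i)) + length (arcs false k (turn false i))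
        ≤⟨ ℕ.+-mono-≤ (length-arcs true k _) (length-arcs false k _) ⟩
      suc k * K + suc k * K ∎)
      where open ℕ.≤-Reasoning

    length-walksFrom : ∀ k i → length (walksFrom k i) ≤ K * suc (suc k * K + suc k * K)
    length-walksFrom k i = ℕ.≤-trans
      (ℕ.≤-reflexive (length-cartesianProductWith _++_ (inside i) (tails k i)))
      (ℕ.*-mono-≤ (length-inside i) (length-tails k i))

    length-simpleWalks : ∀ k → length (simpleWalks k) ≤ m * (K * suc (suc k * K + suc k * K))
    length-simpleWalks k = subst (λ l → length (simpleWalks k) ≤ l * (K * suc (suc k * K + suc k * K)))
      (List.length-tabulate {n = m} id) (sum-bound (allFin m))
      where
      sum-bound : ∀ is → length (concatMap (walksFrom k) is) ≤ length is * (K * suc (suc k * K + suc k * K))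
      sum-bound []       = z≤n
      sum-bound (i ∷ is) = ℕ.≤-trans
        (ℕ.≤-reflexive (List.length-++ (walksFrom k i)))
        (ℕ.+-mono-≤ (length-walksFrom k i) (sum-bound is))

-- Joining port graphs into a connected necklace

-- Descent by unit steps. Steps are demanded only from `hub` upwards, so with hub 1 the descent
-- avoids vertex 0.
chain : ∀ {s} {R : Rel (Fin s) 0ℓ} (hub : Fin s) →
        (∀ x y → toℕ x ≡ suc (toℕ y) → toℕ hub ≤ toℕ y → R x y) →
        ∀ x → toℕ hub ≤ toℕ x → Star R x hub
chain {s} {R} hub step x hub≤x = go (toℕ x) x refl hub≤x
  where
  go : ∀ k x → toℕ x ≡ k → toℕ hub ≤ k → Star R x hub
  go k x eq hub≤k with toℕ hub ℕ.≟ k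
  ... | yes hub≡k = subst (Star R x) (Fin.toℕ-injective (trans eq (sym hub≡k))) ε
  go zero    x eq hub≤0 | no hub≢0 = contradiction (ℕ.n≤0⇒n≡0 hub≤0) hub≢0
  go (suc k) x eq hub≤k | no hub≢k =
    step x y (trans eq (cong suc (sym y≡k))) (subst (toℕ hub ≤_) (sym y≡k) hub≤k′) ◅
    go k y y≡k hub≤k′
    where
    k<s : k < s
    k<s = ℕ.<-trans (ℕ.≤-reflexive (sym eq)) (Fin.toℕ<n x)
    y = fromℕ< k<s
    y≡k : toℕ y ≡ k
    y≡k = Fin.toℕ-fromℕ< k<s
    hub≤k′ : toℕ hub ≤ k
    hub≤k′ = ℕ.≤-pred (ℕ.≤∧≢⇒< hub≤k hub≢k)

-- `feet-nonadjacent` makes each chord a new edge, `turn-injective` keeps the two bridges at a root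
-- distinct, and `turn-moves` keeps a bridge from being a loop.
module Necklace
  {P : Set} (_≟ₚ_ : B.DecidableEquality P)
  {m : ℕ} (size : Fin m → ℕ) (Γ : ∀ i → PortGraph (Fin (size i)) P) (root : ∀ i → Fin (size i))
  (portal : Bool → P) (portal-injective : Injective _≡_ _≡_ portal)
  (feet-nonadjacent : ∀ i d p → PortGraph.nbr (Γ i) (PortGraph.nbr (Γ i) (root i) (portal d)) p ≢
                                PortGraph.nbr (Γ i) (root i) (portal (not d)))
  (turn : Bool → Fin m → Fin m) (turn-inverse : ∀ d i → turn (not d) (turn d i) ≡ i)
  (turn-injective : ∀ i {d e} → turn d i ≡ turn e i → d ≡ e) (turn-moves : ∀ d i → turn d i ≢ i)
  where

  open Bracelet size root turn turn-inverse

  module Γ i = PortGraph (Γ i)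

  foot : Bool → ∀ i → Fin (size i)
  foot d i = Γ.nbr i (root i) (portal d)

  -- The two edges from the root to its feet are replaced by the edge between the feet,
  -- and the freed ports of the root lead to the neighbouring roots.
  data Target (i : Fin m) : Fin (size i) → P → Bead → Set where
    bridge : ∀ d → Target i (root i) (portal d) (rootOf (turn d i))
    chord  : ∀ d {p} → Γ.nbr i (foot d i) p ≡ root i → Target i (foot d i) p (i , foot (not d) i)
    plain  : ∀ {x p} → (∀ d → x ≡ root i → p ≢ portal d) →
             (∀ d → x ≡ foot d i → Γ.nbr i x p ≢ root i) →
             Target i x p (i , Γ.nbr i x p)

  foot-injective : ∀ {i d e} → foot d i ≡ foot e i → d ≡ e
  foot-injective {i} eq = portal-injective (Γ.nbr-injective i (root i) eq)

  anyBool? : ∀ {Q : Bool → Set} → Decidable Q → Dec (∃ Q)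
  anyBool? Q? with Q? true | Q? false
  ... | yes q | _     = yes (true , q)
  ... | no _  | yes q = yes (false , q)
  ... | no ¬t | no ¬f = no λ { (true , q) → ¬t q ; (false , q) → ¬f q }

  target : ∀ i x p → ∃[ y ] Target i x p y
  target i x p with anyBool? (λ d → x Fin.≟ root i ×-dec p ≟ₚ portal d)
                  | anyBool? (λ d → x Fin.≟ foot d i ×-dec Γ.nbr i x p Fin.≟ root i)
  ... | yes (d , refl , refl) | _                   = _ , bridge d
  ... | no _                  | yes (d , refl , eq) = _ , chord d eq
  ... | no ¬bridge            | no ¬chord           =
    _ , plain (λ d x≡ p≡ → ¬bridge (d , x≡ , p≡)) (λ d x≡ eq → ¬chord (d , x≡ , eq))

  root≢foot : ∀ d i → root i ≢ foot d i
  root≢foot d i eq = Γ.loopless i (root i) (portal d) (sym eq)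

  -- The constructors exclude one another, so facts about `Target` carry over to the function
  -- `target` without unfolding its decisions.
  target-functional : ∀ {i x x′ p p′ y y′} → Target i x p y → Target i x′ p′ y′ →
                      x ≡ x′ → p ≡ p′ → y ≡ y′
  target-functional {i} (bridge d) (bridge e) _ eq =
    cong (λ d → rootOf (turn d i)) (portal-injective eq)
  target-functional (bridge d)    (chord e _)   eq _    = contradiction eq (root≢foot e _)
  target-functional (bridge d)    (plain ¬br _) refl eq = contradiction (sym eq) (¬br d refl)
  target-functional (chord d _)   (bridge e)    eq _    = contradiction (sym eq) (root≢foot d _)
  target-functional {i} (chord d _) (chord e _) eq _ =
    cong (λ d → i , foot (not d) i) (foot-injective eq)
  target-functional (chord d eq)  (plain _ ¬ch) refl refl = contradiction eq (¬ch d refl)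
  target-functional (plain ¬br _) (bridge e)    refl eq = contradiction eq (¬br e refl)
  target-functional (plain _ ¬ch) (chord e eq)  refl refl = contradiction eq (¬ch e refl)
  target-functional (plain _ _)   (plain _ _)   refl refl = refl

  ,-injectiveʳ : ∀ {i} {x x′ : Fin (size i)} → _≡_ {A = Bead} (i , x) (i , x′) → x ≡ x′
  ,-injectiveʳ refl = refl

  -- A bridge changes the bead, other edges do not. A chord and a plain edge with the same ends
  -- would make the feet adjacent beforehand.
  target-injective : ∀ {i x x′ p p′ y y′} → Target i x p y → Target i x′ p′ y′ →
                     x ≡ x′ → y ≡ y′ → p ≡ p′
  target-injective {i} (bridge d) (bridge e) _ eq = cong portal (turn-injective i (cong proj₁ eq))
  target-injective (bridge d)    (chord e _)   eq _    = contradiction eq (root≢foot e _)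
  target-injective (bridge d)    (plain _ _)   _ eq    = contradiction (cong proj₁ eq) (turn-moves d _)
  target-injective (chord d _)   (bridge e)    eq _    = contradiction (sym eq) (root≢foot d _)
  target-injective {i} (chord d eq) (chord e eq′) x≡ _ with foot-injective x≡
  ... | refl = Γ.nbr-injective i (foot d i) (trans eq (sym eq′))
  target-injective {i} (chord d _) (plain _ _) refl eq =
    contradiction (sym (,-injectiveʳ eq)) (feet-nonadjacent i d _)
  target-injective (plain _ _)   (bridge e)    _ eq    = contradiction (sym (cong proj₁ eq)) (turn-moves e _)
  target-injective {i} (plain _ _) (chord e _) refl eq =
    contradiction (,-injectiveʳ eq) (feet-nonadjacent i e _)
  target-injective {i} (plain _ _) (plain _ _) refl eq = Γ.nbr-injective i _ (,-injectiveʳ eq)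

  target-loopless : ∀ {i x p y} → Target i x p y → y ≢ (i , x)
  target-loopless (bridge d)  eq = turn-moves d _ (cong proj₁ eq)
  target-loopless (chord d _) eq = Bool.not-¬ refl (sym (foot-injective (,-injectiveʳ eq)))
  target-loopless (plain _ _) eq = Γ.loopless _ _ _ (,-injectiveʳ eq)

  -- On a removed edge, reversal exchanges the port at the root with the one at the foot. Hence the
  -- reverse of a plain port is neither a bridge nor a chord, or the port itself would have been a
  -- chord or a bridge.
  target-back : ∀ {i x p y} → Target i x p y → ∃[ q ] Target (proj₁ y) (proj₂ y) q (i , x)
  target-back {i} (bridge d) = portal (not d) ,
    subst (λ j → Target (turn d i) (root (turn d i)) (portal (not d)) (rootOf j)) (turn-inverse d i)
          (bridge (not d))
  target-back {i} (chord d _) with Γ.back i (root i) (portal (not d))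
  ... | q , eq =
    q , subst (λ e → Target i (foot (not d) i) q (i , foot e i)) (Bool.not-involutive d) (chord (not d) eq)
  target-back {i} (plain {x} {p} ¬bridge ¬chord) with Γ.back i x p
  ... | q , eq = q , subst (λ z → Target i (Γ.nbr i x p) q (i , z)) eq (plain
    (λ { d root≡ refl → ¬chord d (trans (sym eq) (cong (λ z → Γ.nbr i z q) root≡)) root≡ })
    (λ d foot≡ root≡ → ¬bridge d (trans (sym eq) root≡)
      (Γ.nbr-injective i (root i) (trans (cong (λ z → Γ.nbr i z p) (trans (sym root≡) eq)) foot≡))))

  necklace : PortGraph Bead P
  necklace = record
    { nbr           = λ (i , x) p → proj₁ (target i x p)
    ; nbr-injective = λ (i , x) {p} {q} →
        target-injective (proj₂ (target i x p)) (proj₂ (target i x q)) refl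
    ; back          = λ (i , x) p → let q , t = target-back (proj₂ (target i x p)) in
                      q , target-functional (proj₂ (target _ _ q)) t refl refl
    ; loopless      = λ (i , x) p → target-loopless (proj₂ (target i x p))
    }

  open PortGraph necklace using (_~_; ~-sym) public

  target⇒~ : ∀ {i x p y} → Target i x p y → (i , x) ~ y
  target⇒~ {i} {x} {p} t = p , target-functional (proj₂ (target i x p)) t refl refl

  ~⇒step : ∀ {u v} → u ~ v → Step u v
  ~⇒step {i , x} (p , refl) = go (proj₂ (target i x p))
    where
    go : ∀ {i x p y} → Target i x p y → Step (i , x) y
    go (bridge d)  = hop d
    go (chord _ _) = within
    go (plain _ _) = within

  module _
    (hub : ∀ i → Fin (size i))
    (core-connected : ∀ i x → x ≢ root i →
      Star (λ u v → u ≢ root i × v ≢ root i × PortGraph._~_ (Γ i) u v) x (hub i))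
    (spare : P) (spare≢portal : ∀ d → spare ≢ portal d)
    (origin : Fin m) (origin-least : toℕ origin ≡ 0)
    (turn-suc : ∀ i j → toℕ j ≡ suc (toℕ i) → turn true i ≡ j)
    where

    -- Every removed edge contains the root, so edges away from it survive.
    core-edge : ∀ {i u v} → u ≢ root i × v ≢ root i × PortGraph._~_ (Γ i) u v → (i , u) ~ (i , v)
    core-edge (u≢ , v≢ , p , refl) = target⇒~ (plain (λ _ u≡ _ → u≢ u≡) (λ _ _ v≡ → v≢ v≡))

    to-hub : ∀ i x → Star _~_ (i , x) (i , hub i)
    to-hub i x with x Fin.≟ root i
    ... | no x≢root = Star.gmap (i ,_) core-edge (core-connected i x x≢root)
    ... | yes refl  =
      -- The root enters its own bead through a third port; this is where degree at least 3 matters.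
      target⇒~ (plain (λ d _ → spare≢portal d) (λ d root≡ _ → root≢foot d i root≡)) ◅
      Star.gmap (i ,_) core-edge (core-connected i _ (Γ.loopless i (root i) spare))

    to-root : ∀ u → Star _~_ u (rootOf (proj₁ u))
    to-root (i , x) = to-hub i x ◅◅ Star.reverse ~-sym (to-hub i (root i))

    roots-connected : ∀ i → Star _~_ (rootOf i) (rootOf origin)
    roots-connected i = Star.gmap rootOf id
      (chain origin down i (subst (_≤ toℕ i) (sym origin-least) z≤n))
      where
      down : ∀ i j → toℕ i ≡ suc (toℕ j) → toℕ origin ≤ toℕ j → rootOf i ~ rootOf j
      down i j eq _ with turn-suc j i eq
      ... | refl = ~-sym (target⇒~ (bridge true))

    necklace-connected : ∀ u v → Star _~_ u v
    necklace-connected u v = to-origin u ◅◅ Star.reverse ~-sym (to-origin v)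
      where
      to-origin : ∀ u → Star _~_ u (rootOf origin)
      to-origin u = to-root u ◅◅ roots-connected (proj₁ u)

-- Modular shifts and circulant graphs

infixl 6 _⊕_
_⊕_ : ∀ {s} → Fin s → ℕ → Fin s
_⊕_ {suc s} u d = (toℕ u + d) mod suc s

module _ {s : ℕ} where

  toℕ-⊕ : (u : Fin (suc s)) (d : ℕ) → toℕ (u ⊕ d) ≡ (toℕ u + d) % suc s
  toℕ-⊕ u d = Fin.toℕ-fromℕ< (m%n<n (toℕ u + d) (suc s))

  toℕ-⊕-small : (u : Fin (suc s)) (d : ℕ) → toℕ u + d < suc s → toℕ (u ⊕ d) ≡ toℕ u + d
  toℕ-⊕-small u d small = trans (toℕ-⊕ u d) (m<n⇒m%n≡m small)

  ⊕-assoc : (u : Fin (suc s)) (d e : ℕ) → u ⊕ d ⊕ e ≡ u ⊕ (d + e)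
  ⊕-assoc u d e = Fin.toℕ-injective (begin
    toℕ (u ⊕ d ⊕ e)                         ≡⟨ toℕ-⊕ (u ⊕ d) e ⟩
    (toℕ (u ⊕ d) + e) % S                   ≡⟨ cong (λ z → (z + e) % S) (toℕ-⊕ u d) ⟩
    ((toℕ u + d) % S + e) % S               ≡⟨ %-distribˡ-+ ((toℕ u + d) % S) e S ⟩
    ((toℕ u + d) % S % S + e % S) % S       ≡⟨ cong (λ z → (z + e % S) % S) (m%n%n≡m%n (toℕ u + d) S) ⟩
    ((toℕ u + d) % S + e % S) % S           ≡⟨ %-distribˡ-+ (toℕ u + d) e S ⟨
    (toℕ u + d + e) % S                     ≡⟨ cong (_% S) (ℕ.+-assoc (toℕ u) d e) ⟩
    (toℕ u + (d + e)) % S                   ≡⟨ toℕ-⊕ u (d + e) ⟨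
    toℕ (u ⊕ (d + e))                       ∎)
    where
    open ≡-Reasoning
    S = suc s

  ⊕-full : (u : Fin (suc s)) → u ⊕ suc s ≡ u
  ⊕-full u = Fin.toℕ-injective (trans (toℕ-⊕ u (suc s))
    (trans ([m+n]%n≡m%n (toℕ u) (suc s)) (m<n⇒m%n≡m (Fin.toℕ<n u))))

  ⊕-identity : (u : Fin (suc s)) → u ⊕ 0 ≡ u
  ⊕-identity u = Fin.toℕ-injective (trans (toℕ-⊕-small u 0 small) (ℕ.+-identityʳ (toℕ u)))
    where
    small : toℕ u + 0 < suc s
    small = subst (_< suc s) (sym (ℕ.+-identityʳ (toℕ u))) (Fin.toℕ<n u)

  ⊕-inverse : (u : Fin (suc s)) {d e : ℕ} → d + e ≡ suc s → u ⊕ d ⊕ e ≡ u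
  ⊕-inverse u {d} {e} eq = trans (⊕-assoc u d e) (trans (cong (u ⊕_) eq) (⊕-full u))

  private
    -- The second shift undoes the translation by `u` up to one full turn.
    ⊕-recover : (u : Fin (suc s)) {d : ℕ} → d < suc s → toℕ (u ⊕ d ⊕ (suc s ℕ.∸ toℕ u)) ≡ d
    ⊕-recover u {d} d<s = begin
      toℕ (u ⊕ d ⊕ (suc s ℕ.∸ toℕ u))          ≡⟨ cong toℕ (⊕-assoc u d (suc s ℕ.∸ toℕ u)) ⟩
      toℕ (u ⊕ (d + (suc s ℕ.∸ toℕ u)))        ≡⟨ toℕ-⊕ u _ ⟩
      (toℕ u + (d + (suc s ℕ.∸ toℕ u))) % suc s ≡⟨ cong (_% suc s) rearrange ⟩
      (d + suc s) % suc s                      ≡⟨ [m+n]%n≡m%n d (suc s) ⟩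
      d % suc s                                ≡⟨ m<n⇒m%n≡m d<s ⟩
      d                                        ∎
      where
      open ≡-Reasoning
      rearrange : toℕ u + (d + (suc s ℕ.∸ toℕ u)) ≡ d + suc s
      rearrange = begin
        toℕ u + (d + (suc s ℕ.∸ toℕ u)) ≡⟨ ℕ.+-assoc (toℕ u) d _ ⟨
        toℕ u + d + (suc s ℕ.∸ toℕ u)   ≡⟨ cong (_+ (suc s ℕ.∸ toℕ u)) (ℕ.+-comm (toℕ u) d) ⟩
        d + toℕ u + (suc s ℕ.∸ toℕ u)   ≡⟨ ℕ.+-assoc d (toℕ u) _ ⟩
        d + (toℕ u + (suc s ℕ.∸ toℕ u)) ≡⟨ cong (d +_) (ℕ.m+[n∸m]≡n (ℕ.<⇒≤ (Fin.toℕ<n u))) ⟩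
        d + suc s ∎

  ⊕-injective : (u : Fin (suc s)) {d e : ℕ} → d < suc s → e < suc s → u ⊕ d ≡ u ⊕ e → d ≡ e
  ⊕-injective u {d} {e} d<s e<s eq = begin
    d                                ≡⟨ ⊕-recover u d<s ⟨
    toℕ (u ⊕ d ⊕ (suc s ℕ.∸ toℕ u))  ≡⟨ cong (λ z → toℕ (z ⊕ (suc s ℕ.∸ toℕ u))) eq ⟩
    toℕ (u ⊕ e ⊕ (suc s ℕ.∸ toℕ u))  ≡⟨ ⊕-recover u e<s ⟩
    e                                ∎
    where open ≡-Reasoning

-- The ports of a circulant graph of degree 2h + δ, with δ ≤ 1: jumps by ±1, …, ±h and,
-- if δ = 1, the jump to the opposite vertex.
Port : ℕ → ℕ → Set
Port h δ = Fin h ⊎ (Fin h ⊎ Fin δ)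

pattern ahead i    = inj₁ i
pattern behind i   = inj₂ (inj₁ i)
pattern opposite j = inj₂ (inj₂ j)

module _ {h δ : ℕ} where

  -- The jump by -1 and the longest forward jump: the resulting feet are one step too far apart to
  -- be joined by a jump.
  portal : Bool → Port (suc h) δ
  portal true  = behind zero
  portal false = ahead (Fin.fromℕ h)

  portal-injective : Injective _≡_ _≡_ portal
  portal-injective {true}  {true}  _ = refl
  portal-injective {false} {false} _ = refl

-- `δ-irrelevant` says that δ is at most 1. The vertex count has to be twice `q` only when an
-- opposite port exists, hence the guard `Fin δ`.
module Circulant (h₀ δ s : ℕ) (2h<s : suc h₀ + suc h₀ < suc s)
                 (δ-irrelevant : (i j : Fin δ) → i ≡ j)
                 (q : ℕ) (q+q≡s : Fin δ → q + q ≡ suc s) where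

  private
    h : ℕ
    h = suc h₀

  jump : Port h δ → ℕ
  jump (ahead i)    = suc (toℕ i)
  jump (behind i)   = suc s ℕ.∸ suc (toℕ i)
  jump (opposite _) = q

  reverse : Port h δ → Port h δ
  reverse (ahead i)    = behind i
  reverse (behind i)   = ahead i
  reverse (opposite j) = opposite j

  private
    h≤s : h ≤ suc s
    h≤s = ℕ.<⇒≤ (ℕ.≤-<-trans (ℕ.m≤m+n h h) 2h<s)

    i≤s : (i : Fin h) → suc (toℕ i) ≤ suc s
    i≤s i = ℕ.≤-trans (Fin.toℕ<n i) h≤s

    sum-small : (i j : Fin h) → suc (toℕ i) + suc (toℕ j) ≢ suc s
    sum-small i j = ℕ.<⇒≢ (ℕ.≤-<-trans (ℕ.+-mono-≤ (Fin.toℕ<n i) (Fin.toℕ<n j)) 2h<s)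

    h<q : Fin δ → h < q
    h<q j = ℕ.≰⇒> λ q≤h → ℕ.<-irrefl refl
      (ℕ.≤-<-trans (ℕ.≤-trans (ℕ.≤-reflexive (sym (q+q≡s j))) (ℕ.+-mono-≤ q≤h q≤h)) 2h<s)

  jump-reverse : ∀ p → jump p + jump (reverse p) ≡ suc s
  jump-reverse (ahead i)    = ℕ.m+[n∸m]≡n (i≤s i)
  jump-reverse (behind i)   = ℕ.m∸n+n≡m (i≤s i)
  jump-reverse (opposite j) = q+q≡s j

  jump-positive : ∀ p → 0 < jump p
  jump-positive (ahead i)    = s≤s z≤n
  jump-positive (behind i)   = ℕ.m<n⇒0<n∸m (ℕ.≤-<-trans (Fin.toℕ<n i) (ℕ.≤-<-trans (ℕ.m≤m+n h h) 2h<s))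
  jump-positive (opposite j) = ℕ.≤-<-trans z≤n (h<q j)

  jump<s : ∀ p → jump p < suc s
  jump<s p = subst (jump p <_) (jump-reverse p) (ℕ.m<m+n (jump p) (jump-positive (reverse p)))

  private
    ahead≢behind : ∀ i j → jump (ahead i) ≢ jump (behind j)
    ahead≢behind i j eq = sum-small i j (trans (cong (_+ suc (toℕ j)) eq) (ℕ.m∸n+n≡m (i≤s j)))

    ahead≢opposite : ∀ i j → jump (ahead i) ≢ jump (opposite j)
    ahead≢opposite i j = ℕ.<⇒≢ (ℕ.≤-<-trans (Fin.toℕ<n i) (h<q j))

    behind≢opposite : ∀ i j → jump (behind i) ≢ jump (opposite j)
    behind≢opposite i j eq = ahead≢opposite i j (ℕ.+-cancelʳ-≡ q _ q (begin
      jump (ahead i) + q               ≡⟨ cong (jump (ahead i) +_) eq ⟨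
      jump (ahead i) + jump (behind i) ≡⟨ jump-reverse (ahead i) ⟩
      suc s                            ≡⟨ q+q≡s j ⟨
      q + q                            ∎))
      where open ≡-Reasoning

  jump-injective : ∀ {p p′} → jump p ≡ jump p′ → p ≡ p′
  jump-injective {ahead i}    {ahead j}    eq = cong ahead (Fin.toℕ-injective (ℕ.suc-injective eq))
  jump-injective {ahead i}    {behind j}   eq = contradiction eq (ahead≢behind i j)
  jump-injective {ahead i}    {opposite j} eq = contradiction eq (ahead≢opposite i j)
  jump-injective {behind i}   {ahead j}    eq = contradiction (sym eq) (ahead≢behind j i)
  jump-injective {behind i}   {behind j}   eq =
    cong behind (Fin.toℕ-injective (ℕ.suc-injective (ℕ.∸-cancelˡ-≡ (i≤s i) (i≤s j) eq)))
  jump-injective {behind i}   {opposite j} eq = contradiction eq (behind≢opposite i j)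
  jump-injective {opposite i} {ahead j}    eq = contradiction (sym eq) (ahead≢opposite j i)
  jump-injective {opposite i} {behind j}   eq = contradiction (sym eq) (behind≢opposite j i)
  jump-injective {opposite i} {opposite j} eq = cong opposite (δ-irrelevant i j)

  circulant : PortGraph (Fin (suc s)) (Port h δ)
  circulant = record
    { nbr           = λ u p → u ⊕ jump p
    ; nbr-injective = λ u {p} {p′} eq → jump-injective (⊕-injective u (jump<s p) (jump<s p′) eq)
    ; back          = λ u p → reverse p , ⊕-inverse u (jump-reverse p)
    ; loopless      = λ u p eq → ℕ.<⇒≢ (jump-positive p)
        (sym (⊕-injective u (jump<s p) (s≤s z≤n) (trans eq (sym (⊕-identity u)))))
    }

  open PortGraph circulant using (_~_; ~-sym)

  private
    1<s : 1 < suc s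
    1<s = ℕ.≤-trans (ℕ.+-mono-≤ (s≤s z≤n) (s≤s z≤n)) (ℕ.<⇒≤ 2h<s)

  step-down : (x y : Fin (suc s)) → toℕ x ≡ suc (toℕ y) → x ~ y
  step-down x y eq = ~-sym (ahead zero , Fin.toℕ-injective
    (trans (toℕ-⊕-small y 1 (subst (_< suc s) x≡y+1 (Fin.toℕ<n x))) (sym x≡y+1)))
    where
    x≡y+1 : toℕ x ≡ toℕ y + 1
    x≡y+1 = trans eq (ℕ.+-comm 1 (toℕ y))

  circulant-connected : ∀ u v → Star _~_ u v
  circulant-connected u v = to-zero u ◅◅ Star.reverse ~-sym (to-zero v)
    where
    to-zero : ∀ u → Star _~_ u zero
    to-zero u = chain zero (λ x y eq _ → step-down x y eq) u z≤n

  hub : Fin (suc s)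
  hub = fromℕ< 1<s

  -- Deleting 0 cuts the cycle of unit jumps into a path, which still visits all other vertices.
  core-connected : ∀ x → x ≢ zero → Star (λ u v → u ≢ zero × v ≢ zero × u ~ v) x hub
  core-connected x x≢0 = chain hub
    (λ x y eq hub≤y → positive x (subst (0 <_) (sym eq) (s≤s z≤n)) ,
      positive y (subst (_≤ toℕ y) hub≡1 hub≤y) , step-down x y eq)
    x (subst (_≤ toℕ x) (sym hub≡1) (ℕ.n≢0⇒n>0 (x≢0 ∘ Fin.toℕ-injective)))
    where
    hub≡1 : toℕ hub ≡ 1
    hub≡1 = Fin.toℕ-fromℕ< 1<s
    positive : (x : Fin (suc s)) → 0 < toℕ x → x ≢ zero
    positive x 0<x refl = ℕ.<-irrefl refl 0<x

  foot : Bool → Fin (suc s)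
  foot d = zero ⊕ jump (portal d)

  private
    -- The feet are the vertices -1 and h, and h + 1 is not a jump.
    jump≢1+h : h + h + 2 < suc s → ∀ p → jump p ≢ suc h
    jump≢1+h large (ahead i)    eq = ℕ.<⇒≢ (s≤s (Fin.toℕ<n i)) eq
    jump≢1+h large (behind i)   eq = ℕ.<⇒≢ (ℕ.≤-<-trans sum≤ large)
      (trans (cong (_+ suc (toℕ i)) (sym eq)) (ℕ.m∸n+n≡m (i≤s i)))
      where
      sum≤ : suc h + suc (toℕ i) ≤ h + h + 2
      sum≤ = begin
        suc h + suc (toℕ i) ≤⟨ ℕ.+-monoʳ-≤ (suc h) (Fin.toℕ<n i) ⟩
        suc (h + h)         ≤⟨ ℕ.n≤1+n _ ⟩
        2 + (h + h)         ≡⟨ ℕ.+-comm 2 (h + h) ⟩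
        h + h + 2           ∎
        where open ℕ.≤-Reasoning
    jump≢1+h large (opposite j) eq = ℕ.<⇒≢ large (begin
      h + h + 2       ≡⟨ ℕ.+-assoc h h 2 ⟩
      h + (h + 2)     ≡⟨ cong (h +_) (ℕ.+-comm h 2) ⟩
      h + (2 + h)     ≡⟨ ℕ.+-suc h (suc h) ⟩
      suc h + suc h   ≡⟨ cong₂ _+_ eq eq ⟨
      q + q           ≡⟨ q+q≡s j ⟩
      suc s           ∎)
      where open ≡-Reasoning

    feet-apart : h + h + 2 < suc s → ∀ p → foot true ⊕ jump p ≢ foot false
    feet-apart large p eq = jump≢1+h large p (⊕-injective (foot true) (jump<s p) 1+h<s (begin
      foot true ⊕ jump p           ≡⟨ eq ⟩
      foot false                   ≡⟨ cong (λ k → zero ⊕ suc k) (Fin.toℕ-fromℕ h₀) ⟩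
      zero ⊕ h                     ≡⟨ cong (_⊕ h) (⊕-full zero) ⟨
      zero ⊕ suc s ⊕ h             ≡⟨ ⊕-assoc zero (suc s) h ⟩
      zero ⊕ (suc s + h)           ≡⟨ cong (zero ⊕_) (ℕ.+-suc s h) ⟨
      zero ⊕ (s + suc h)           ≡⟨ ⊕-assoc zero s (suc h) ⟨
      foot true ⊕ suc h            ∎))
      where
      open ≡-Reasoning
      1+h<s : suc h < suc s
      1+h<s = ℕ.≤-<-trans (ℕ.≤-trans (s≤s (ℕ.m≤n+m h h₀)) (ℕ.m≤m+n (h + h) 2)) large

  feet-nonadjacent : h + h + 2 < suc s → ∀ d p → foot d ⊕ jump p ≢ foot (not d)
  feet-nonadjacent large true  p eq = feet-apart large p eq
  feet-nonadjacent large false p eq = feet-apart large (reverse p) (begin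
    foot true ⊕ jump (reverse p)           ≡⟨ cong (_⊕ jump (reverse p)) eq ⟨
    foot false ⊕ jump p ⊕ jump (reverse p) ≡⟨ ⊕-inverse (foot false) (jump-reverse p) ⟩
    foot false                             ∎)
    where open ≡-Reasoning

-- Numbering the vertices and ports, and the ring of beads

Σ-Fin↔ : ∀ {k} (size : Fin k → ℕ) → (∃[ i ] Fin (size i)) ↔ Fin (sum (tabulate size))
Σ-Fin↔ {zero}  size = mk↔ₛ′ (λ ()) (λ ()) (λ ()) (λ ())
Σ-Fin↔ {suc k} size =
  ↔-trans head-or-tail (↔-trans (↔-refl ⊎-↔ Σ-Fin↔ (size ∘ suc)) (↔-sym Fin.+↔⊎))
  where
  head-or-tail : (∃[ i ] Fin (size i)) ↔ (Fin (size zero) ⊎ (∃[ i ] Fin (size (suc i))))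
  head-or-tail = mk↔ₛ′
    (λ { (zero , x) → inj₁ x ; (suc i , x) → inj₂ (i , x) })
    (λ { (inj₁ x) → zero , x ; (inj₂ (i , x)) → suc i , x })
    (λ { (inj₁ x) → refl ; (inj₂ (i , x)) → refl })
    (λ { (zero , x) → refl ; (suc i , x) → refl })

sum-constant : ∀ k c → sum (tabulate {n = k} (λ _ → c)) ≡ k * c
sum-constant zero    c = refl
sum-constant (suc k) c = cong (c +_) (sum-constant k c)

port↔ : ∀ h δ → Port h δ ↔ Fin (h + (h + δ))
port↔ h δ = ↔-sym (↔-trans Fin.+↔⊎ (↔-refl ⊎-↔ Fin.+↔⊎))

-- With at least three beads the shifts 1 and -1, the latter written `suc (suc k)`, are distinct.
module Cycle (k : ℕ) where

  private
    m : ℕ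
    m = suc (suc (suc k))

    jump<m : ∀ d → (if d then 1 else suc (suc k)) < m
    jump<m true  = s≤s (s≤s z≤n)
    jump<m false = ℕ.≤-refl

  turn : Bool → Fin m → Fin m
  turn d i = i ⊕ (if d then 1 else suc (suc k))

  turn-inverse : ∀ d i → turn (not d) (turn d i) ≡ i
  turn-inverse true  i = ⊕-inverse i refl
  turn-inverse false i = ⊕-inverse i (ℕ.+-comm (suc (suc k)) 1)

  turn-injective : ∀ i {d e} → turn d i ≡ turn e i → d ≡ e
  turn-injective i {d} {e} eq = cases d e (⊕-injective i (jump<m d) (jump<m e) eq)
    where
    cases : ∀ d e → (if d then 1 else suc (suc k)) ≡ (if e then 1 else suc (suc k)) → d ≡ e
    cases true  true  _ = refl
    cases false false _ = refl

  turn-moves : ∀ d i → turn d i ≢ i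
  turn-moves d i eq = nonzero d (⊕-injective i (jump<m d) (s≤s z≤n) (trans eq (sym (⊕-identity i))))
    where
    nonzero : ∀ d → (if d then 1 else suc (suc k)) ≢ 0
    nonzero true  ()
    nonzero false ()

  turn-suc : ∀ i j → toℕ j ≡ suc (toℕ i) → turn true i ≡ j
  turn-suc i j eq = Fin.toℕ-injective
    (trans (toℕ-⊕-small i 1 (subst (_< m) j≡i+1 (Fin.toℕ<n j))) (sym j≡i+1))
    where
    j≡i+1 : toℕ j ≡ toℕ i + 1
    j≡i+1 = trans eq (ℕ.+-comm 1 (toℕ i))

-- Regular graphs with few paths in every admissible order

-- Everything is rounded up to multiples of nK: the 1 to one of them and each (n + 1)K to two, which
-- gives the 5.
walk-count-≤ : ∀ m n K → m ≤ n → 1 ≤ n → 1 ≤ K →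
               m * (K * suc (suc n * K + suc n * K)) ≤ K * (5 * K) * n ℕ.^ 2
walk-count-≤ m n K m≤n 1≤n 1≤K = begin
  m * (K * suc (suc n * K + suc n * K))
    ≤⟨ ℕ.*-mono-≤ m≤n (ℕ.*-monoʳ-≤ K (ℕ.+-mono-≤ {1} one (ℕ.+-mono-≤ two two))) ⟩
  n * (K * (n * K + ((n + n) * K + (n + n) * K)))
    ≡⟨ solve 2 (λ n K → n :* (K :* (n :* K :+ ((n :+ n) :* K :+ (n :+ n) :* K)))
                        := K :* (con 5 :* K) :* (n :* (n :* con 1))) refl n K ⟩
  K * (5 * K) * n ℕ.^ 2 ∎
  where
  open ℕ.≤-Reasoning
  open +-*-Solver
  one : 1 ≤ n * K
  one = ℕ.*-mono-≤ 1≤n 1≤K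
  two : suc n * K ≤ (n + n) * K
  two = ℕ.*-monoˡ-≤ K (ℕ.+-monoˡ-≤ n 1≤n)

half-even : ∀ {s} → 2 ∣ s → s / 2 + s / 2 ≡ s
half-even {s} 2∣s = trans (solve 1 (λ x → x :+ x := x :* con 2) refl (s / 2)) (m/n*n≡m 2∣s)
  where open +-*-Solver

module Construction (h₀ δ : ℕ) (δ-irrelevant : (i j : Fin δ) → i ≡ j)
                    (spare : Port (suc h₀) δ) (spare≢portal : ∀ d → spare ≢ portal d) where

  h r base base-1 : ℕ
  h      = suc h₀
  r      = h + (h + δ)
  -- Thus `base` is 2h + 4: more than the 2h + 2 that keeps the feet nonadjacent, and even, so that
  -- beads of odd degree have opposite vertices.
  base-1 = h₀ + 2 + (h + 2)
  base   = suc base-1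

  -- Abstract, since numLists bound bound must never be evaluated.
  abstract
    bound : ℕ
    bound = 3 * base

    bound≡3base : bound ≡ 3 * base
    bound≡3base = refl

  factor : ℕ
  factor = numLists bound bound * (5 * numLists bound bound)

  ≤bound : ∀ {a} → a ≤ 3 * base → a ≤ bound
  ≤bound {a} = subst (a ≤_) (sym bound≡3base)

  circulant-graph : ∀ s → r < suc s → (Fin δ → 2 ∣ suc s) →
                    ∃[ G ] Connected {suc s} G × Regular r G
  circulant-graph s r<s even = graph , connected circulant-connected , regular
    where
    open Circulant h₀ δ s (ℕ.≤-<-trans (ℕ.+-monoʳ-≤ h (ℕ.m≤m+n h δ)) r<s) δ-irrelevant
                   (suc s / 2) (λ j → half-even (even j))
    open Realise ↔-refl (port↔ h δ) circulant

  2∣base : 2 ∣ base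
  2∣base = subst (2 ∣_)
    (solve 1 (λ x → con 2 :* (x :+ con 2) := x :+ con 2 :+ (x :+ con 2)) refl h)
    (m∣m*n (h + 2))
    where open +-*-Solver

  necklace-graph : ∀ t k → t ≤ base → (Fin δ → 2 ∣ t) →
    let n = base + t + suc (suc k) * base in
    ∃[ G ] Connected {n} G × Regular r G × pn G ≤ factor * n ℕ.^ 2
  necklace-graph t k t≤base even-t = graph , connected beads-connected , regular , few-paths
    where
    m : ℕ
    m = suc (suc (suc k))

    pred-size : Fin m → ℕ
    pred-size zero    = base-1 + t
    pred-size (suc i) = base-1

    base≤size : ∀ i → base ≤ suc (pred-size i)
    base≤size zero    = ℕ.m≤m+n base t
    base≤size (suc i) = ℕ.≤-refl

    size≤bound : ∀ i → suc (pred-size i) ≤ bound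
    size≤bound zero    = ≤bound (ℕ.+-monoʳ-≤ base (ℕ.≤-trans t≤base (ℕ.m≤m+n base _)))
    size≤bound (suc i) = ≤bound (ℕ.m≤m+n base _)

    even-size : Fin δ → ∀ i → 2 ∣ suc (pred-size i)
    even-size j zero    = ∣m∣n⇒∣m+n 2∣base (even-t j)
    even-size j (suc i) = 2∣base

    large : ∀ i → h + h + 2 < suc (pred-size i)
    large i = ℕ.<-≤-trans (ℕ.≤-trans (ℕ.n≤1+n _) (ℕ.≤-reflexive
      (solve 1 (λ x → con 2 :+ (x :+ x :+ con 2) := x :+ con 2 :+ (x :+ con 2)) refl h))) (base≤size i)
      where open +-*-Solver

    2h<s : ∀ i → h + h < suc (pred-size i)
    2h<s i = ℕ.≤-<-trans (ℕ.m≤m+n (h + h) 2) (large i)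

    module C i = Circulant h₀ δ (pred-size i) (2h<s i) δ-irrelevant
                           (suc (pred-size i) / 2) (λ j → half-even (even-size j i))

    open Cycle k

    portal-inj : Injective _≡_ _≡_ (portal {h₀} {δ})
    portal-inj = portal-injective

    module N = Necklace
      (Sum.≡-dec Fin._≟_ (Sum.≡-dec Fin._≟_ Fin._≟_)) {m = m} (suc ∘ pred-size) C.circulant
      (λ _ → zero) portal portal-inj (λ i → C.feet-nonadjacent i (large i))
      turn turn-inverse turn-injective turn-moves

    open Bracelet (suc ∘ pred-size) (λ _ → zero) turn turn-inverse

    n : ℕ
    n = base + t + suc (suc k) * base

    bead↔ : Bead ↔ Fin n
    bead↔ = subst (λ l → Bead ↔ Fin l) (cong (base + t +_) (sum-constant (suc (suc k)) base))
                  (Σ-Fin↔ (suc ∘ pred-size))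

    open Realise bead↔ (port↔ h δ) N.necklace

    beads-connected : ∀ u v → Star N._~_ u v
    beads-connected = N.necklace-connected C.hub C.core-connected spare spare≢portal zero refl turn-suc

    few-paths : pn graph ≤ factor * n ℕ.^ 2
    few-paths = begin
      pn graph
        ≤⟨ pn-graph-≤ (simpleWalks size≤bound n)
             (λ (walk , uniq) → ∈-simpleWalks size≤bound n (relaxWalk N.~⇒step walk , uniq)) ⟩
      length (simpleWalks size≤bound n)
        ≤⟨ length-simpleWalks size≤bound n ⟩
      m * (numLists bound bound * suc (suc n * numLists bound bound + suc n * numLists bound bound))
        ≤⟨ walk-count-≤ m n (numLists bound bound)
             (ℕ.+-mono-≤ {1} (s≤s z≤n) (ℕ.m≤m*n (suc (suc k)) base)) (s≤s z≤n) (numLists-positive bound bound) ⟩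
      factor * n ℕ.^ 2 ∎
      where open ℕ.≤-Reasoning

  factor-positive : 1 ≤ factor
  factor-positive = ℕ.*-mono-≤ (numLists-positive bound bound)
    (ℕ.*-mono-≤ {1} {5} (s≤s z≤n) (numLists-positive bound bound))

  -- A port in `Fin δ` means that the degree is 2h + 1, so rn and n have the same parity.
  even-order : ∀ {n} → 2 ∣ r * n → Fin δ → 2 ∣ n
  even-order {n} 2∣rn j = ∣m+n∣m⇒∣n (subst (2 ∣_) expand 2∣rn) (m∣m*n (h * n))
    where
    open +-*-Solver
    one : ∀ δ → ((i j : Fin δ) → i ≡ j) → Fin δ → δ ≡ 1
    one (suc zero)    _   _ = refl
    one (suc (suc _)) irr _ with irr zero (suc zero)
    ... | ()
    expand : r * n ≡ 2 * (h * n) + n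
    expand = trans (cong (λ δ → (h + (h + δ)) * n) (one δ δ-irrelevant j))
      (solve 2 (λ h n → (h :+ (h :+ con 1)) :* n := con 2 :* (h :* n) :+ n) refl h n)

  FewPathsGraph : ℕ → Set
  FewPathsGraph n = ∃[ G ] Connected {n} G × Regular r G × pn G ≤ factor * n ℕ.^ 2

  -- Any connected regular graph will do here, since its path number is below a constant and n is
  -- positive.
  small-order : ∀ s → suc s ≤ bound → r < suc s → (Fin δ → 2 ∣ suc s) → FewPathsGraph (suc s)
  small-order s n≤bound r<n even = G , proj₁ (proj₂ found) , proj₂ (proj₂ found) , (begin
    pn G                  ≤⟨ pn≤numLists G n≤bound ⟩
    K                     ≡⟨ ℕ.*-identityʳ K ⟨
    K * 1                 ≤⟨ ℕ.*-monoʳ-≤ K (ℕ.*-mono-≤ {1} {5} (s≤s z≤n) (numLists-positive bound bound)) ⟩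
    factor                ≡⟨ ℕ.*-identityʳ factor ⟨
    factor * 1            ≤⟨ ℕ.*-monoʳ-≤ factor (ℕ.m^n>0 (suc s) 2) ⟩
    factor * suc s ℕ.^ 2  ∎)
    where
    open ℕ.≤-Reasoning
    K = numLists bound bound
    found = circulant-graph s r<n even
    G = proj₁ found

  -- From 3 * `base` on, the quotient by `base` supplies the three beads a ring needs. The remainder
  -- goes into one bead and is even whenever n is, because `base` is even.
  large-order : ∀ n → bound ≤ n → (Fin δ → 2 ∣ n) → FewPathsGraph n
  large-order n bound≤n even =
    from-quotient (n / base) (m≡m%n+[m/n]*n n base)
      (subst (_≤ n / base) (m*n/n≡m 3 base) (/-monoˡ-≤ base (subst (_≤ n) bound≡3base bound≤n)))
    where
    from-quotient : ∀ q → n ≡ n % base + q * base → 3 ≤ q → FewPathsGraph n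
    from-quotient (suc (suc (suc k))) eq _ = subst FewPathsGraph (sym (begin
      n                                       ≡⟨ eq ⟩
      n % base + (base + suc (suc k) * base)  ≡⟨ ℕ.+-assoc (n % base) base _ ⟨
      n % base + base + suc (suc k) * base    ≡⟨ cong (_+ suc (suc k) * base) (ℕ.+-comm (n % base) base) ⟩
      base + n % base + suc (suc k) * base    ∎))
      (necklace-graph (n % base) k (m%n≤n n base) (λ j → %-presˡ-∣ (even j) 2∣base))
      where open ≡-Reasoning
    from-quotient (suc (suc zero)) _ (s≤s (s≤s ()))
    from-quotient (suc zero)       _ (s≤s ())

  few-paths-graph : ∀ n → r + 1 ≤ n → 2 ∣ r * n → FewPathsGraph n
  few-paths-graph zero    r+1≤n _    = contradiction r+1≤n λ ()
  few-paths-graph (suc s) r+1≤n 2∣rn = by-size (suc s ℕ.≤? bound)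
    where
    by-size : Dec (suc s ≤ bound) → FewPathsGraph (suc s)
    by-size (yes n≤bound) =
      small-order s n≤bound (subst (_≤ suc s) (ℕ.+-comm r 1) r+1≤n) (even-order 2∣rn)
    by-size (no n≰bound)  = large-order (suc s) (ℕ.<⇒≤ (ℕ.≰⇒> n≰bound)) (even-order 2∣rn)

-- The indices are spelled like the number of ports, so that matching identifies the degree with the
-- `r` of `Construction`.
data Halved : ℕ → Set where
  even : ∀ h → Halved (h + (h + 0))
  odd  : ∀ h → Halved (h + (h + 1))

halve : ∀ r → Halved r
halve zero       = even 0
halve (suc zero) = odd 0
halve (suc (suc r)) with halve r
... | even h = subst Halved (cong suc (ℕ.+-suc h (h + 0))) (even (suc h))
... | odd h  = subst Halved (cong suc (ℕ.+-suc h (h + 1))) (odd (suc h))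

QuadraticGraphs : ℕ → Set
QuadraticGraphs r = ∃[ C ] 1 ≤ C × (∀ n → r + 1 ≤ n → 2 ∣ r * n →
                    ∃[ G ] Connected {n} G × Regular r G × pn G ≤ C * n ℕ.^ 2)

quadratic-graphs : ∀ {r} → Halved r → 3 ≤ r → QuadraticGraphs r
quadratic-graphs (even zero)          ()
quadratic-graphs (even (suc zero))    (s≤s (s≤s ()))
quadratic-graphs (odd zero)           (s≤s ())
quadratic-graphs (even (suc (suc h))) _ = factor , factor-positive , few-paths-graph
  where
  irrelevant : (i j : Fin 0) → i ≡ j
  irrelevant ()
  ahead-free : ∀ d → ahead zero ≢ portal {suc h} {0} d
  ahead-free true  ()
  ahead-free false ()
  -- With two or more forward jumps the jump by 1 is not the longest one, hence not a portal.
  open Construction (suc h) 0 irrelevant (ahead zero) ahead-free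
quadratic-graphs (odd (suc h)) _ = factor , factor-positive , few-paths-graph
  where
  irrelevant : (i j : Fin 1) → i ≡ j
  irrelevant zero zero = refl
  opposite-free : ∀ d → opposite zero ≢ portal {h} {1} d
  opposite-free true  ()
  opposite-free false ()
  -- In degree 3 the only forward jump is a portal, so the opposite port has to serve as the spare
  -- one.
  open Construction h 1 irrelevant (opposite zero) opposite-free

-- Rational constants and the minimum

toℚᵘ-fromℕ : ∀ m → toℚᵘ (fromℕ m) ℚᵘ.≃ mkℚᵘ (ℤ.+ m) 0
toℚᵘ-fromℕ m = ℚ.toℚᵘ-fromℚᵘ (mkℚᵘ (ℤ.+ m) 0)

fromℕ-mono-≤ : ∀ {a b} → a ≤ b → fromℕ a ℚ.≤ fromℕ b
fromℕ-mono-≤ {a} {b} a≤b = ℚ.toℚᵘ-cancel-≤ (begin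
  toℚᵘ (fromℕ a)  ≃⟨ toℚᵘ-fromℕ a ⟩
  mkℚᵘ (ℤ.+ a) 0  ≤⟨ *≤* (ℤ.*-monoʳ-≤-nonNeg (ℤ.+ 1) (ℤ.+≤+ a≤b)) ⟩
  mkℚᵘ (ℤ.+ b) 0  ≃⟨ toℚᵘ-fromℕ b ⟨
  toℚᵘ (fromℕ b)  ∎)
  where open ℚᵘ.≤-Reasoning

fromℕ-homo-* : ∀ a b → fromℕ (a * b) ≡ fromℕ a ℚ.* fromℕ b
fromℕ-homo-* a b = ℚ.toℚᵘ-injective (begin-equality
  toℚᵘ (fromℕ (a * b))                ≃⟨ toℚᵘ-fromℕ (a * b) ⟩
  mkℚᵘ (ℤ.+ (a * b)) 0                ≃⟨ *≡* (cong (ℤ._* ℤ.+ 1) (ℤ.pos-* a b)) ⟩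
  mkℚᵘ (ℤ.+ a) 0 ℚᵘ.* mkℚᵘ (ℤ.+ b) 0  ≃⟨ ℚᵘ.*-cong (toℚᵘ-fromℕ a) (toℚᵘ-fromℕ b) ⟨
  toℚᵘ (fromℕ a) ℚᵘ.* toℚᵘ (fromℕ b)  ≃⟨ ℚ.toℚᵘ-homo-* (fromℕ a) (fromℕ b) ⟨
  toℚᵘ (fromℕ a ℚ.* fromℕ b)          ∎)
  where open ℚᵘ.≤-Reasoning

½-fromℕ-≤ : ∀ {a b} → a ≤ 2 * b → ½ ℚ.* fromℕ a ℚ.≤ fromℕ b
½-fromℕ-≤ {a} {b} a≤2b = begin
  ½ ℚ.* fromℕ a               ≤⟨ ℚ.*-monoˡ-≤-nonNeg ½ (fromℕ-mono-≤ a≤2b) ⟩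
  ½ ℚ.* fromℕ (2 * b)         ≡⟨ cong (½ ℚ.*_) (fromℕ-homo-* 2 b) ⟩
  ½ ℚ.* (fromℕ 2 ℚ.* fromℕ b) ≡⟨ ℚ.*-assoc ½ (fromℕ 2) (fromℕ b) ⟨
  -- Here `½ ℚ.* fromℕ 2` evaluates to `1ℚ`.
  1ℚ ℚ.* fromℕ b              ≡⟨ ℚ.*-identityˡ (fromℕ b) ⟩
  fromℕ b                     ∎
  where open ℚ.≤-Reasoning

theorem2 : (r : ℕ) → 3 ℕ.≤ r →
    ∃[ c ] ∃[ C ] 0ℚ ℚ.< c × 0ℚ ℚ.< C ×
    ((n : ℕ) → r ℕ.+ 1 ℕ.≤ n → 2 ∣ r ℕ.* n →
    ∃[ m ] IsMinimum (PathNumbers r n) m ×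
    c ℚ.* fromℕ (n ℕ.^ 2) ℚ.≤ fromℕ m ×
    fromℕ m ℚ.≤ C ℚ.* fromℕ (n ℕ.^ 2))
theorem2 r 3≤r =
  ½ , fromℕ C , ℚ.positive⁻¹ ½ ,
  ℚ.<-≤-trans (ℚ.positive⁻¹ 1ℚ) (fromℕ-mono-≤ (proj₁ (proj₂ family))) , quadratic
  where
  family : QuadraticGraphs r
  family = quadratic-graphs (halve r) 3≤r
  C : ℕ
  C = proj₁ family

  Sandwiched : ℕ → ℕ → Set
  Sandwiched n m = IsMinimum (PathNumbers r n) m ×
    ½ ℚ.* fromℕ (n ℕ.^ 2) ℚ.≤ fromℕ m × fromℕ m ℚ.≤ fromℕ C ℚ.* fromℕ (n ℕ.^ 2)

  -- The lower bound is applied to the graph `G′` that attains the minimum, the upper bound to the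
  -- constructed `G`, whose path number the minimum cannot exceed.
  sandwich : ∀ {n m} (G : Graph n) → Connected G → Regular r G → pn G ≤ C * n ℕ.^ 2 →
             IsMinimum (PathNumbers r n) m → Sandwiched n m
  sandwich {n} {m} G conn reg pn≤ isMin@((G′ , conn′ , _ , pn≡m) , least) =
    isMin ,
    ½-fromℕ-≤ {n ℕ.^ 2} {m}
      (subst₂ (λ k l → k ≤ 2 * l) (cong (n *_) (sym (ℕ.*-identityʳ n))) pn≡m (n²≤2pn G′ conn′)) ,
    subst (fromℕ m ℚ.≤_) (fromℕ-homo-* C (n ℕ.^ 2))
      (fromℕ-mono-≤ (ℕ.≤-trans (least (pn G) (G , conn , reg , refl)) pn≤))

  quadratic : ∀ n → r + 1 ≤ n → 2 ∣ r * n → ∃[ m ] Sandwiched n m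
  quadratic n r+1≤n 2∣rn =
    let G , conn , reg , pn≤ = proj₂ (proj₂ family) n r+1≤n 2∣rn
        m , isMin            = minimum pathNumbers? (pn G) (G , conn , reg , refl)
    in m , sandwich G conn reg pn≤ isMin
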